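{- Let $k\ge 2$ and suppose a set of $k$ polygons of pairwise distinct colors $1,\dots,k$ is given, each with at least $2$ sides, and let $n\ge1$ be such that the total number of sides of the polygons equals $n+k+1$. Then the number of $(1,n)$-constellations glued from these polygons is equal to $(k-1)n^{k-2}$.
   Context: A $k$-constellation is a connected colored oriented graph consisting of oriented polygons (each with at least 2 sides) colored in colors $1,\dots,k$, such that no two polygons of the same color share a common vertex. It has a natural embedding into a compact oriented surface such that: cutting along the graph gives open discs; each polygon bounds one such disc and is oriented counterclockwise with respect to it; the cyclic order of polygons at each vertex coincides with the increasing order of colors. The discs not bounded by polygons are called faces. A $(1,n)$-constellation is a constellation with $n+1$ vertices whose natural embedding surface is a sphere, whose exterior (the complement of the polygons) consists of exactly two faces, and such that along the boundary cycle of one of these faces (the small cycle) the colors of the edges are pairwise distinct and appear in the cyclic order inverse to the cyclic order of the colors (the small cycle need not contain polygons of all colors). -}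

module Defs where

open import Data.Nat using (ℕ; zero; suc; _+_; _≤_)
open import Data.Nat.DivMod using (_%_; m%n<n)
open import Data.Fin using (Fin; toℕ; fromℕ<) renaming (_<_ to _<ᶠ_; _≤_ to _≤ᶠ_)
open import Data.Fin.Permutation using (Permutation′; _⟨$⟩ʳ_)
open import Data.Product using (Σ; ∃; ∃₂; _×_; _,_; proj₁)
open import Data.Sum using (_⊎_)
open import Data.List using (List; length)
open import Data.List.Relation.Unary.All using (All)
open import Data.List.Relation.Unary.Any using (Any)
open import Data.List.Relation.Unary.AllPairs using (AllPairs)
open import Relation.Binary.PropositionalEquality using (_≡_)
open import Relation.Binary.Construct.Closure.ReflexiveTransitive using (Star)
open import Relation.Nullary using (¬_)
open import Function.Definitions using (Injective)

addMod : ∀ {l} → Fin l → ℕ → Fin l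
addMod {suc l} i r = fromℕ< (m%n<n (toℕ i + r) (suc l))

sucMod : ∀ {l} → Fin l → Fin l
sucMod i = addMod i 1

-- Gluings.
--
-- k polygons, polygon of colour c (c : Fin k, colours 1..k ≅ Fin k)
-- has ℓ c sides; its corners are Fin (ℓ c), in their cyclic
-- (counterclockwise) order, side j going from corner j to corner
-- sucMod j.  A gluing onto the vertex set Fin m assigns a vertex to
-- each corner of each polygon.

Gluing : (k : ℕ) → (Fin k → ℕ) → ℕ → Set
Gluing k ℓ m = (c : Fin k) → Fin (ℓ c) → Fin m

Corner : (k : ℕ) → (Fin k → ℕ) → Set
Corner k ℓ = Σ (Fin k) (λ c → Fin (ℓ c))

module _ {k : ℕ} {ℓ : Fin k → ℕ} {m : ℕ} (f : Gluing k ℓ m) where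

  PolygonsEmbedded : Set
  PolygonsEmbedded = ∀ c → Injective _≡_ _≡_ (f c)

  Adjacent : Fin m → Fin m → Set
  Adjacent u v = ∃₂ λ (c : Fin k) (j : Fin (ℓ c)) →
    (f c j ≡ u × f c (sucMod j) ≡ v) ⊎ (f c j ≡ v × f c (sucMod j) ≡ u)

  Connected : Set
  Connected = ∀ u v → Star Adjacent u v

  Present : Fin m → Fin k → Set
  Present v d = ∃ λ (j : Fin (ℓ d)) → f d j ≡ v

  -- x lies strictly between a and b in the cyclic order of colours,
  -- going upward from a (when b ≡ a: x is any colour other than a)
  CycBetween : Fin k → Fin k → Fin k → Set
  CycBetween a x b = (a <ᶠ b × a <ᶠ x × x <ᶠ b) ⊎ (b ≤ᶠ a × (a <ᶠ x ⊎ x <ᶠ b))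

  -- Faces of the exterior.  At each vertex the polygons appear
  -- counterclockwise in increasing order of colours; a corner (c , j)
  -- stands for the exterior angle at v = f c j lying counterclockwise
  -- right after the polygon of colour c, whose face boundary arrives at v
  -- along the side of colour c.  Following that face boundary (along the
  -- orientation of the sides) one leaves v along the outgoing side of the
  -- polygon of colour c' = next colour present at v after c (cyclically),
  -- arriving at the corner (c' , sucMod j') where f c' j' ≡ v.
  Next : Corner k ℓ → Corner k ℓ → Set
  Next (c , j) (c′ , j″) = Σ (Fin (ℓ c′)) λ j′ →
    f c′ j′ ≡ f c j × j″ ≡ sucMod j′ ×
    (∀ d → Present (f c j) d → ¬ CycBetween c d c′)

  -- z lies on the same exterior face as x
  Orbit : Corner k ℓ → Corner k ℓ → Set
  Orbit = Star Next

  -- The face through x is a "small cycle": the colours of its sides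
  -- (= colours of its corners) are pairwise distinct, and along the
  -- orientation of the sides they increase cyclically, i.e. read along the
  -- boundary of the face in the positive (counterclockwise) direction they
  -- appear in the order inverse to the cyclic order of colours.
  SmallFace : Corner k ℓ → Set
  SmallFace x =
    (∀ z w → Orbit x z → Orbit x w → proj₁ z ≡ proj₁ w → z ≡ w) ×
    (∀ z z′ w → Orbit x z → Next z z′ → Orbit x w →
       ¬ CycBetween (proj₁ z) (proj₁ w) (proj₁ z′))

sumFin : ∀ {k} → (Fin k → ℕ) → ℕ
sumFin {zero} ℓ = 0
sumFin {suc k} ℓ = ℓ Fin.zero + sumFin (λ i → ℓ (Fin.suc i))

IsOneNConstellation : (k : ℕ) (ℓ : Fin k → ℕ) (n : ℕ) → Gluing k ℓ (suc n) → Set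
IsOneNConstellation k ℓ n f =
  PolygonsEmbedded f × Connected f ×
  -- sphere: Euler characteristic V - E + F = 2, where F = k polygon
  -- discs + 2 exterior faces
  (suc n + (k + 2) ≡ sumFin ℓ + 2) ×
  (∃₂ λ x y → ¬ Orbit f x y × (∀ z → Orbit f x z ⊎ Orbit f y z) × SmallFace f x)

-- isomorphism of gluings: relabel vertices and rotate each polygon
-- (rotations only: polygons are oriented and colours are fixed)
Isomorphic : ∀ {k ℓ m} → Gluing k ℓ m → Gluing k ℓ m → Set
Isomorphic {k} {ℓ} {m} f g =
  Σ (Permutation′ m) λ π → Σ (Fin k → ℕ) λ r →
    ∀ c j → π ⟨$⟩ʳ f c j ≡ g c (addMod j (r c))

NumberUpTo : {A : Set} → (A → A → Set) → (A → Set) → ℕ → Set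
NumberUpTo {A} R P N = Σ (List A) λ xs →
  length xs ≡ N × All P xs × AllPairs (λ x y → ¬ R x y) xs ×
  (∀ a → P a → Any (R a) xs)

{-# OPTIONS --safe #-}
-- Call a corner of each polygon its base. A (1,n)-constellation has n + 1 vertices and ∑ (ℓ c - 1) = n + 1
-- non-base corners, and bases can be chosen so that every vertex is a non-base corner of exactly one
-- polygon: on the small cycle the base precedes the corner lying on the cycle, elsewhere it is the corner
-- closest to the cycle. The constellation is then a map F sending each colour to the vertex of its base.
-- If S is the set of colours on the small cycle and q d is the vertex following the base of the cyclic
-- predecessor of d in S, the maps that occur are exactly those with F d = q d for d ∈ S and F d ≠ q d for
-- d ∉ S in which every colour leads to S. Contracting colours one at a time shows that there are
-- (∑_{c ∈ S} (ℓ c - 1) - 1) n^{k-|S|-1} of them, and the sum over |S| ≥ 2 is (k - 1) n^{k-2}.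
module Submission where

open import Defs
open import Data.Bool using (Bool; true; false; if_then_else_)
open import Data.Bool.Properties using () renaming (_≟_ to _≟ᵇ_)
open import Data.Empty using (⊥; ⊥-elim)
open import Data.Fin using (Fin; zero; suc; toℕ; fromℕ<; splitAt; _↑ˡ_; _↑ʳ_; join; punchOut)
open import Data.Fin.Permutation using (Permutation′; permutation; _⟨$⟩ʳ_; _⟨$⟩ˡ_; inverseˡ)
import Data.Fin.Properties as Fin
open import Data.List using ([]; _∷_; map; _++_)
open import Data.List.Properties using (length-map; length-++)
open import Data.List.Relation.Unary.All as All using (All; []; _∷_)
import Data.List.Relation.Unary.All.Properties as All
open import Data.List.Relation.Unary.AllPairs using (AllPairs; []; _∷_)
import Data.List.Relation.Unary.AllPairs.Properties as AllPairs
open import Data.List.Relation.Unary.Any as Any using (here)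
import Data.List.Relation.Unary.Any.Properties as Any
open import Data.Maybe using (Maybe; nothing; just)
open import Data.Nat using (ℕ; zero; suc; pred; _+_; _*_; _∸_; _^_; _≤_; _<_; z≤n; s≤s; NonZero; >-nonZero; _<?_)
open import Data.Nat.DivMod
open import Data.Nat.Induction using (<-rec)
open import Data.Nat.Properties
open import Data.Nat.Tactic.RingSolver using (solve-∀)
open import Data.Product using (Σ; ∃; ∃₂; _×_; _,_; proj₁; proj₂)
open import Data.Sum as Sum using (_⊎_; inj₁; inj₂; [_,_]′)
open import Data.Unit using (⊤; tt)
open import Data.Vec using (Vec; []; _∷_; lookup; tabulate)
import Data.Vec.Functional as Vector
open import Data.Vec.Properties using (lookup∘tabulate)
open import Function using (_∘_)
open import Function.Definitions using (Injective)
open import Relation.Binary.Construct.Closure.ReflexiveTransitive using (Star; ε; _◅_; _◅◅_; reverse)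
open import Relation.Binary.PropositionalEquality
open import Relation.Nullary using (¬_; Dec; yes; no; does; contradiction; ¬?)
open import Relation.Nullary.Decidable using (dec-true; _×-dec_)
open import Relation.Unary using (Decidable)

-- Counting up to an equivalence

-- The exponent k - |S| - 1 is -1 when `S` contains every colour, so each count is carried
-- multiplied by n, and the factors n are cancelled only after summing over `S`. Choosing bases in a
-- given constellation shows directly only that every vertex is a non-base corner of at least one
-- polygon; that it is exactly one follows from the number of sides, because a surjection between
-- finite sets of equal size is a bijection. The main obstacle is that an isomorphism might rotate a
-- polygon away from its base, so that one constellation could have two codes. Such a rotation
-- spreads from a polygon to the one carrying its base, in the source as well as in the target, and
-- the two carrying maps are inverse to each other on rotated polygons. Rotated polygons therefore
-- lie on the small cycle, and the cycle would have to increase in both directions. Two colours are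
-- the only case where this is possible, and there the two codes turn out to be equal.

number-empty : {A : Set} {R : A → A → Set} {P : A → Set} → (∀ a → ¬ P a) → NumberUpTo R P 0
number-empty ¬P = [] , refl , [] , [] , λ a Pa → contradiction Pa (¬P a)

number-⊎ : {A : Set} {R : A → A → Set} {P Q : A → Set} {m n : ℕ} →
  (∀ a b → P a → Q b → ¬ R a b) → NumberUpTo R P m → NumberUpTo R Q n →
  NumberUpTo R (λ a → P a ⊎ Q a) (m + n)
number-⊎ disjoint (xs , refl , Pxs , xs! , complete) (ys , refl , Qys , ys! , complete′) =
  xs ++ ys , length-++ xs ,
  All.++⁺ (All.map inj₁ Pxs) (All.map inj₂ Qys) ,
  AllPairs.++⁺ xs! ys! (All.map (λ Pa → All.map (disjoint _ _ Pa) Qys) Pxs) ,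
  λ { a (inj₁ Pa) → Any.++⁺ˡ (complete a Pa) ; a (inj₂ Qa) → Any.++⁺ʳ xs (complete′ a Qa) }

-- `R` and `R′` are not assumed to be equivalences; `respects` is the one instance of transitivity
-- that lets a preimage be replaced by its listed representative.
number-map : {A B : Set} {R : A → A → Set} {R′ : B → B → Set} {P : A → Set} {Q : B → Set} {n : ℕ} →
  (g : A → B) → (∀ a → P a → Q (g a)) →
  (∀ a b → P a → P b → R′ (g a) (g b) → R a b) →
  (∀ b → Q b → ∃ λ a → P a × R′ b (g a)) →
  (∀ b a a′ → R′ b (g a) → R a a′ → R′ b (g a′)) →
  NumberUpTo R P n → NumberUpTo R′ Q n
number-map {R = R} {R′} {P} g P⇒Q reflects onto respects (xs , refl , Pxs , xs! , complete) =
  map g xs , length-map g xs , All.map⁺ (All.map (P⇒Q _) Pxs) , AllPairs.map⁺ (distinct Pxs xs!) ,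
  λ b Qb → let a , Pa , ba = onto b Qb in Any.map⁺ (Any.map (respects b a _ ba) (complete a Pa))
  where
  distinct : ∀ {ys} → All P ys → AllPairs (λ x y → ¬ R x y) ys →
             AllPairs (λ x y → ¬ R′ (g x) (g y)) ys
  distinct [] [] = []
  distinct (Py ∷ Pys) (y! ∷ ys!) =
    All.zipWith (λ (Pz , ¬yz) → ¬yz ∘ reflects _ _ Py Pz) (Pys , y!) ∷ distinct Pys ys!

number-⇔ : {A : Set} {R : A → A → Set} {P Q : A → Set} {n : ℕ} →
  (∀ a → P a → Q a) → (∀ a → Q a → P a) → NumberUpTo R P n → NumberUpTo R Q n
number-⇔ P⇒Q Q⇒P (xs , len , Pxs , xs! , complete) =
  xs , len , All.map (P⇒Q _) Pxs , xs! , λ a Qa → complete a (Q⇒P a Qa)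

number-Fin : {A : Set} {R : A → A → Set} {n : ℕ} {P : Fin n → A → Set} {N : Fin n → ℕ} →
  (∀ i j a b → P i a → P j b → R a b → i ≡ j) → (∀ i → NumberUpTo R (P i) (N i)) →
  NumberUpTo R (λ a → ∃ λ i → P i a) (sumFin N)
number-Fin {n = zero} _ _ = number-empty λ _ ()
number-Fin {n = suc n} disjoint count =
  number-⇔ (λ { a (inj₁ p) → zero , p ; a (inj₂ (i , p)) → suc i , p })
           (λ { a (zero , p) → inj₁ p ; a (suc i , p) → inj₂ (i , p) })
    (number-⊎ (λ { a b p (i , q) r → case (disjoint zero (suc i) a b p q r) })
      (count zero)
      (number-Fin (λ i j a b p q r → Fin.suc-injective (disjoint (suc i) (suc j) a b p q r))
                  (λ i → count (suc i))))
  where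
  case : ∀ {i : Fin n} → zero ≡ suc i → ⊥
  case ()

-- A sum over all sets of colours. Sets are vectors rather than functions so that equal sets are
-- propositionally equal.
sumVec : ∀ {k} → (Vec Bool k → ℕ) → ℕ
sumVec {zero} g = g []
sumVec {suc k} g = sumVec (λ S → g (true ∷ S)) + sumVec (λ S → g (false ∷ S))

number-Vec : ∀ {k} {A : Set} {R : A → A → Set} {P : Vec Bool k → A → Set} {N : Vec Bool k → ℕ} →
  (∀ S T a b → P S a → P T b → R a b → S ≡ T) → (∀ S → NumberUpTo R (P S) (N S)) →
  NumberUpTo R (λ a → ∃ λ S → P S a) (sumVec N)
number-Vec {zero} disjoint count =
  number-⇔ (λ a p → [] , p) (λ { a ([] , p) → p }) (count [])
number-Vec {suc k} disjoint count =
  number-⇔ (λ { a (inj₁ (S , p)) → true ∷ S , p ; a (inj₂ (S , p)) → false ∷ S , p })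
           (λ { a (true ∷ S , p) → inj₁ (S , p) ; a (false ∷ S , p) → inj₂ (S , p) })
    (number-⊎ (λ { a b (S , p) (T , q) r → true≢false (disjoint _ _ a b p q r) })
      (half true) (half false))
  where
  true≢false : ∀ {S T : Vec Bool k} → ¬ (true ∷ S ≡ false ∷ T)
  true≢false ()
  ∷-injective : ∀ {x} {S T : Vec Bool k} → x ∷ S ≡ x ∷ T → S ≡ T
  ∷-injective refl = refl
  half : ∀ x → NumberUpTo _ _ _
  half x = number-Vec (λ S T a b p q r → ∷-injective (disjoint (x ∷ S) (x ∷ T) a b p q r))
                      (λ S → count (x ∷ S))

-- Finite sums

sumFin-cong : ∀ {n} {g h : Fin n → ℕ} → (∀ i → g i ≡ h i) → sumFin g ≡ sumFin h
sumFin-cong {zero} _ = refl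
sumFin-cong {suc n} eq = cong₂ _+_ (eq zero) (sumFin-cong (eq ∘ suc))

sumFin-+ : ∀ {n} (g h : Fin n → ℕ) → sumFin (λ i → g i + h i) ≡ sumFin g + sumFin h
sumFin-+ {zero} g h = refl
sumFin-+ {suc n} g h = trans (cong (g zero + h zero +_) (sumFin-+ (g ∘ suc) (h ∘ suc)))
  (interchange (g zero) (h zero) (sumFin (g ∘ suc)) (sumFin (h ∘ suc)))
  where
  interchange : ∀ a b c d → a + b + (c + d) ≡ a + c + (b + d)
  interchange = solve-∀

sumFin-*ʳ : ∀ {n} (g : Fin n → ℕ) x → sumFin (λ i → g i * x) ≡ sumFin g * x
sumFin-*ʳ {zero} g x = refl
sumFin-*ʳ {suc n} g x = trans (cong (g zero * x +_) (sumFin-*ʳ (g ∘ suc) x))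
  (sym (*-distribʳ-+ x (g zero) (sumFin (g ∘ suc))))

sumFin-const : ∀ n x → sumFin {n} (λ _ → x) ≡ n * x
sumFin-const zero x = refl
sumFin-const (suc n) x = cong (x +_) (sumFin-const n x)

sumFin-≟ : ∀ {n} (i : Fin n) → sumFin (λ j → if does (j Fin.≟ i) then 1 else 0) ≡ 1
sumFin-≟ {suc n} zero = cong suc (trans (sumFin-const n 0) (*-zeroʳ n))
sumFin-≟ {suc n} (suc i) = sumFin-≟ i

encode : ∀ {k} (w : Fin k → ℕ) → Σ (Fin k) (Fin ∘ w) → Fin (sumFin w)
encode w (zero , p) = p ↑ˡ _
encode w (suc c , p) = w zero ↑ʳ encode (w ∘ suc) (c , p)

decode-split : ∀ {k} (w : Fin (suc k) → ℕ) →
  (Fin (sumFin (w ∘ suc)) → Σ (Fin k) (Fin ∘ w ∘ suc)) →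
  Fin (w zero) ⊎ Fin (sumFin (w ∘ suc)) → Σ (Fin (suc k)) (Fin ∘ w)
decode-split w rec (inj₁ p) = zero , p
decode-split w rec (inj₂ v) = let c , p = rec v in suc c , p

decode : ∀ {k} (w : Fin k → ℕ) → Fin (sumFin w) → Σ (Fin k) (Fin ∘ w)
decode {suc k} w v = decode-split w (decode (w ∘ suc)) (splitAt (w zero) v)

decode-encode : ∀ {k} (w : Fin k → ℕ) x → decode w (encode w x) ≡ x
decode-encode {suc k} w (zero , p) =
  cong (decode-split w (decode (w ∘ suc))) (Fin.splitAt-↑ˡ (w zero) p _)
decode-encode {suc k} w (suc c , p) =
  trans (cong (decode-split w (decode (w ∘ suc))) (Fin.splitAt-↑ʳ (w zero) _ _))
        (cong (λ (c , p) → suc c , p) (decode-encode (w ∘ suc) (c , p)))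

encode-decode : ∀ {k} (w : Fin k → ℕ) v → encode w (decode w v) ≡ v
encode-decode {suc k} w v = trans (split (splitAt (w zero) v)) (Fin.join-splitAt (w zero) _ v)
  where
  split : ∀ s → encode w (decode-split w (decode (w ∘ suc)) s) ≡ join (w zero) _ s
  split (inj₁ p) = refl
  split (inj₂ v) = cong (w zero ↑ʳ_) (encode-decode (w ∘ suc) v)

sumFin-++ : ∀ a b (g : Fin (a + b) → ℕ) →
  sumFin g ≡ sumFin (λ i → g (i ↑ˡ b)) + sumFin (λ j → g (a ↑ʳ j))
sumFin-++ zero b g = refl
sumFin-++ (suc a) b g = trans (cong (g zero +_) (sumFin-++ a b (g ∘ suc))) (sym (+-assoc (g zero) _ _))

sumFin-decode : ∀ {k} (w : Fin k → ℕ) (g : Fin k → ℕ) →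
  sumFin (λ v → g (proj₁ (decode w v))) ≡ sumFin (λ c → w c * g c)
sumFin-decode {zero} w g = refl
sumFin-decode {suc k} w g = trans (sumFin-++ (w zero) _ _) (cong₂ _+_
  (trans (sumFin-cong λ p → cong (g ∘ proj₁ ∘ decode-split w (decode (w ∘ suc))) (Fin.splitAt-↑ˡ (w zero) p _))
         (sumFin-const (w zero) (g zero)))
  (trans (sumFin-cong λ v → cong (g ∘ proj₁ ∘ decode-split w (decode (w ∘ suc))) (Fin.splitAt-↑ʳ (w zero) _ v))
         (sumFin-decode (w ∘ suc) (g ∘ suc))))

-- Rooted forests

-- Value v : V belongs to the block of colour c when o v ≡ just c, and to the core when o v ≡ nothing.
data Rooted {r : ℕ} {V : Set} (o : V → Maybe (Fin r)) (F : Fin r → V) (d : Fin r) : Set where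
  root : o (F d) ≡ nothing → Rooted o F d
  step : ∀ {e} → o (F d) ≡ just e → Rooted o F e → Rooted o F d

-- A colour pointing into its own block would have to walk forever, while a derivation of `Rooted`
-- is finite.
Rooted-irreflexive : ∀ {r V} {o : V → Maybe (Fin r)} {F d} → Rooted o F d → ¬ (o (F d) ≡ just d)
Rooted-irreflexive (root eq) eq′ with () ← trans (sym eq) eq′
Rooted-irreflexive (step eq rooted) eq′ with refl ← trans (sym eq) eq′ = Rooted-irreflexive rooted eq′

-- The first argument is the block containing `F zero`: block zero is dissolved into it and the
-- other colours move down by one. The value for `just zero` twice is a dummy, since no rooted
-- colour points to itself.
contract : ∀ {r} → Maybe (Fin (suc r)) → Maybe (Fin (suc r)) → Maybe (Fin r)
contract _ nothing = nothing
contract _ (just (suc e)) = just e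
contract (just (suc e)) (just zero) = just e
contract _ (just zero) = nothing

module _ {r : ℕ} {V : Set} {o : V → Maybe (Fin (suc r))} {F : Fin (suc r) → V} where

  -- Visits to colour zero are skipped; two visits in a row are excluded by `Rooted-irreflexive`.
  Rooted-contract : ∀ {x} → o (F zero) ≡ x → ∀ {d} → Rooted o F (suc d) → Rooted (contract x ∘ o) (F ∘ suc) d
  Rooted-contract eq₀ (root eq) = root (cong (contract _) eq)
  Rooted-contract eq₀ (step {suc e} eq re) = step (cong (contract _) eq) (Rooted-contract eq₀ re)
  Rooted-contract refl (step {zero} eq (root eq₀)) =
    root (trans (cong (contract _) eq) (cong (λ x → contract x (just zero)) eq₀))
  Rooted-contract refl (step {zero} eq (step {suc e} eq₀ re)) =
    step (trans (cong (contract _) eq) (cong (λ x → contract x (just zero)) eq₀)) (Rooted-contract refl re)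
  Rooted-contract eq₀′ (step {zero} eq (step {zero} eq₀ re)) = contradiction eq₀ (Rooted-irreflexive re)

  -- The visit to colour zero is reinserted whenever `F (suc d)` lies in block zero.
  Rooted-expand : ∀ {x} → o (F zero) ≡ x → ¬ (x ≡ just zero) →
    ∀ {d} → Rooted (contract x ∘ o) (F ∘ suc) d → Rooted o F (suc d)
  Rooted-expand {x} eq₀ ne {d} re with o (F (suc d)) in eq
  ... | nothing = root eq
  Rooted-expand {x} eq₀ ne {d} (root eq′) | just (suc e) with () ← trans (sym eq′) (cong (contract x) eq)
  Rooted-expand {x} eq₀ ne {d} (step eq′ re) | just (suc e) with refl ← trans (sym eq′) (cong (contract x) eq) =
    step eq (Rooted-expand eq₀ ne re)
  Rooted-expand {nothing} eq₀ ne {d} re | just zero = step eq (root eq₀)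
  Rooted-expand {just zero} eq₀ ne {d} re | just zero = contradiction refl ne
  Rooted-expand {just (suc e)} eq₀ ne {d} (root eq′) | just zero
    with () ← trans (sym eq′) (cong (contract (just (suc e))) eq)
  Rooted-expand {just (suc e)} eq₀ ne {d} (step eq′ re) | just zero
    with refl ← trans (sym eq′) (cong (contract (just (suc e))) eq) =
    step eq (step eq₀ (Rooted-expand eq₀ ne re))

  Rooted-expand-zero : ∀ {x} → o (F zero) ≡ x → ¬ (x ≡ just zero) →
    (∀ d → Rooted (contract x ∘ o) (F ∘ suc) d) → Rooted o F zero
  Rooted-expand-zero {nothing} eq₀ ne all = root eq₀
  Rooted-expand-zero {just zero} eq₀ ne all = contradiction refl ne
  Rooted-expand-zero {just (suc e)} eq₀ ne all = step eq₀ (Rooted-expand eq₀ ne (all e))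

Forest : ∀ {r n} → Vec Bool r → (Fin r → Fin n) → (Fin n → Maybe (Fin r)) → (Fin r → Fin n) → Set
Forest S q o F = (∀ d → lookup S d ≡ true → F d ≡ q d) ×
                 (∀ d → lookup S d ≡ false → ¬ (F d ≡ q d)) ×
                 (∀ d → Rooted o F d)

outside : ∀ {r} → Vec Bool r → ℕ
outside [] = 0
outside (true ∷ S) = outside S
outside (false ∷ S) = suc (outside S)

inCore : ∀ {r} → Maybe (Fin r) → ℕ
inCore nothing = 1
inCore (just _) = 0

inZero : ∀ {r} → Maybe (Fin (suc r)) → ℕ
inZero (just zero) = 1
inZero _ = 0

inCore-contract : ∀ {r} (x y : Maybe (Fin (suc r))) → ¬ (x ≡ just zero) →
  inCore (contract x y) ≡ inCore y + inCore x * inZero y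
inCore-contract x nothing ne = cong suc (sym (*-zeroʳ (inCore x)))
inCore-contract x (just (suc e)) ne = sym (*-zeroʳ (inCore x))
inCore-contract nothing (just zero) ne = refl
inCore-contract (just zero) (just zero) ne = contradiction refl ne
inCore-contract (just (suc _)) (just zero) ne = refl

contract-block : ∀ {r} {d : Fin r} x y → contract x y ≡ just d → y ≡ just (suc d) ⊎ x ≡ just (suc d)
contract-block x (just (suc e)) refl = inj₁ refl
contract-block (just (suc e)) (just zero) refl = inj₂ refl

-- The forests with F 0 ≡ v are the forests in which colour 0 has been merged into the block of v,
-- so summing over v gives an induction on the number of colours.
forest-count : ∀ {r n} (S : Vec Bool r) (q : Fin r → Fin (suc n)) (o : Fin (suc n) → Maybe (Fin r)) (C : ℕ) →
  (∀ d → o (q d) ≡ nothing) → (∀ d v → lookup S d ≡ true → ¬ (o v ≡ just d)) →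
  sumFin (inCore ∘ o) ≡ suc C →
  ∃ λ X → NumberUpTo _≗_ (Forest S q o) X × X * n ≡ C * n ^ outside S
forest-count {n = n} [] q o C core empty size =
  1 , (q ∷ [] , refl , ((λ ()) , (λ ()) , λ ()) ∷ [] , [] ∷ [] , λ _ _ → here λ ()) ,
  -- With no colours left every vertex is in the core, so `C` equals `n`.
  (begin 1 * n ≡⟨ *-comm 1 n ⟩ n * 1 ≡⟨ cong (_* 1) (suc-injective n≡C) ⟩ C * 1 ∎)
  where
  open ≡-Reasoning
  all-core : ∀ v → inCore (o v) ≡ 1
  all-core v with o v
  ... | nothing = refl
  n≡C : suc n ≡ suc C
  n≡C = trans (sym (*-identityʳ (suc n))) (trans (sym (sumFin-const (suc n) 1)) (trans (sym (sumFin-cong all-core)) size))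
forest-count {suc r} {n} (true ∷ S) q o C core empty size =
  -- Colour zero goes to the core vertex `q zero` and its own block is empty, so contracting it
  -- leaves the core as large as before.
  let X , count , eq = forest-count S (q ∘ suc) (contract nothing ∘ o) C
        (λ d → cong (contract nothing) (core (suc d)))
        (λ d v d∈S eq → [ empty (suc d) v d∈S , (λ ()) ]′ (contract-block nothing (o v) eq))
        (trans (sumFin-cong same) size)
  in X , number-map (λ F → q zero Vector.∷ F) sound (λ _ _ _ _ eq d → eq (suc d)) onto
           (λ { _ _ _ eq eq′ zero → eq zero ; _ _ _ eq eq′ (suc d) → trans (eq (suc d)) (eq′ d) }) count , eq
  where
  same : ∀ v → inCore (contract nothing (o v)) ≡ inCore (o v)
  same v = trans (inCore-contract nothing (o v) (λ ())) (go (o v) refl)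
    where
    go : ∀ x → o v ≡ x → inCore x + 1 * inZero x ≡ inCore x
    go nothing _ = refl
    go (just zero) eq = contradiction eq (empty zero v refl)
    go (just (suc _)) _ = refl
  sound : ∀ F → Forest S (q ∘ suc) (contract nothing ∘ o) F → Forest (true ∷ S) q o (q zero Vector.∷ F)
  sound F (eq , ne , rooted) = (λ { zero _ → refl ; (suc d) → eq d }) , (λ { (suc d) → ne d }) ,
    λ { zero → root (core zero) ; (suc d) → Rooted-expand (core zero) (λ ()) (rooted d) }
  onto : ∀ F → Forest (true ∷ S) q o F →
    ∃ λ F′ → Forest S (q ∘ suc) (contract nothing ∘ o) F′ × (F ≗ (q zero Vector.∷ F′))
  onto F (eq , ne , rooted) = F ∘ suc ,
    (eq ∘ suc , ne ∘ suc , λ d → Rooted-contract (trans (cong o (eq zero refl)) (core zero)) (rooted (suc d))) ,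
    λ { zero → eq zero refl ; (suc d) → refl }
forest-count {suc r} {n} (false ∷ S) q o C core empty size =
  sumFin X ,
  number-⇔ (λ { F (v , _ , forest) → forest }) (λ F forest → F zero , refl , forest)
    (number-Fin (λ { u v F G (eqF , _) (eqG , _) eq → trans (sym eqF) (trans (eq zero) eqG) }) (λ v → proj₁ (proj₂ (branch v)))) ,
  (begin
    sumFin X * n ≡⟨ sumFin-*ʳ X n ⟨
    sumFin (λ v → X v * n) ≡⟨ sumFin-cong (λ v → proj₂ (proj₂ (branch v))) ⟩
    sumFin (λ v → γ v * n ^ outside S) ≡⟨ sumFin-*ʳ γ (n ^ outside S) ⟩
    sumFin γ * n ^ outside S ≡⟨ cong (_* n ^ outside S) sum-γ ⟩
    C * n * n ^ outside S ≡⟨ *-assoc C n _ ⟩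
    C * n ^ outside (false ∷ S) ∎)
  where
  open ≡-Reasoning
  w₀ = sumFin (inZero ∘ o)

  -- The core size minus one after colour zero has been sent to a vertex of the given block. The two
  -- zeros not depending on `C` are the forbidden vertex `q zero` and a colour pointing to itself.
  weight : Bool → Maybe (Fin (suc r)) → ℕ
  weight true _ = 0
  weight false nothing = C + w₀
  weight false (just zero) = 0
  weight false (just (suc _)) = C

  γ : Fin (suc n) → ℕ
  γ v = weight (does (v Fin.≟ q zero)) (o v)

  indicator : Fin (suc n) → ℕ
  indicator v = if does (v Fin.≟ q zero) then 1 else 0

  -- Returning what `q zero` and block zero lack makes the weight uniform: `C` everywhere and `w₀`
  -- more on the core. Summed, this is C * (C + w₀) + C * (n - C - w₀) = C * n without subtraction.
  balance : ∀ v → γ v + (indicator v * (C + w₀) + inZero (o v) * C) ≡ C + inCore (o v) * w₀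
  balance v with v Fin.≟ q zero
  ... | yes refl rewrite core zero = identity C w₀
    where
    identity : ∀ a b → 1 * (a + b) + 0 ≡ a + 1 * b
    identity = solve-∀
  ... | no _ with o v
  ... | nothing = identity C w₀
    where
    identity : ∀ a b → a + b + 0 ≡ a + 1 * b
    identity = solve-∀
  ... | just zero = refl
  ... | just (suc _) = refl

  -- The block size `w₀` cancels, which is why the number of forests depends only on the core size
  -- and not on how the rest is divided into blocks.
  sum-γ : sumFin γ ≡ C * n
  sum-γ = +-cancelʳ-≡ (C + w₀ + w₀ * C) _ _ (begin
    sumFin γ + (C + w₀ + w₀ * C)
      ≡⟨ cong (λ x → sumFin γ + (x + w₀ * C)) (trans (cong (_* (C + w₀)) (sumFin-≟ (q zero))) (*-identityˡ _)) ⟨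
    sumFin γ + (sumFin indicator * (C + w₀) + w₀ * C)
      ≡⟨ cong (sumFin γ +_) (cong₂ _+_ (sumFin-*ʳ indicator (C + w₀)) (sumFin-*ʳ (inZero ∘ o) C)) ⟨
    sumFin γ + (sumFin (λ v → indicator v * (C + w₀)) + sumFin (λ v → inZero (o v) * C))
      ≡⟨ cong (sumFin γ +_) (sumFin-+ (λ v → indicator v * (C + w₀)) (λ v → inZero (o v) * C)) ⟨
    sumFin γ + sumFin (λ v → indicator v * (C + w₀) + inZero (o v) * C)
      ≡⟨ sumFin-+ γ (λ v → indicator v * (C + w₀) + inZero (o v) * C) ⟨
    sumFin (λ v → γ v + (indicator v * (C + w₀) + inZero (o v) * C)) ≡⟨ sumFin-cong balance ⟩
    sumFin (λ v → C + inCore (o v) * w₀) ≡⟨ sumFin-+ (λ _ → C) (λ v → inCore (o v) * w₀) ⟩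
    sumFin {suc n} (λ _ → C) + sumFin (λ v → inCore (o v) * w₀)
      ≡⟨ cong₂ _+_ (sumFin-const (suc n) C) (trans (sumFin-*ʳ (inCore ∘ o) w₀) (cong (_* w₀) size)) ⟩
    suc n * C + suc C * w₀ ≡⟨ identity n C w₀ ⟩
    C * n + (C + w₀ + w₀ * C) ∎)
    where
    identity : ∀ n a b → (1 + n) * a + (1 + a) * b ≡ a * n + (a + b + b * a)
    identity = solve-∀

  Branch : Fin (suc n) → (Fin (suc r) → Fin (suc n)) → Set
  Branch v F = F zero ≡ v × Forest (false ∷ S) q o F

  module _ (v : Fin (suc n)) (x : Maybe (Fin (suc r))) (eq : o v ≡ x) (v≢q : ¬ (v ≡ q zero)) (x≢0 : ¬ (x ≡ just zero)) where

    allowed : ∀ C′ → C′ ≡ C + inCore x * w₀ →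
      ∃ λ X → NumberUpTo _≗_ (Branch v) X × X * n ≡ C′ * n ^ outside S
    allowed C′ refl =
      let X , count , eq = forest-count S (q ∘ suc) (contract x ∘ o) (C + inCore x * w₀)
            (λ d → cong (contract x) (core (suc d)))
            (λ d u d∈S eq′ → [ empty (suc d) u d∈S , (λ eq″ → empty (suc d) v d∈S (trans eq eq″)) ]′ (contract-block x (o u) eq′))
            (begin
              sumFin (inCore ∘ contract x ∘ o) ≡⟨ sumFin-cong (λ u → trans (inCore-contract x (o u) x≢0) (cong (inCore (o u) +_) (*-comm (inCore x) _))) ⟩
              sumFin (λ u → inCore (o u) + inZero (o u) * inCore x) ≡⟨ sumFin-+ (inCore ∘ o) (λ u → inZero (o u) * inCore x) ⟩
              sumFin (inCore ∘ o) + sumFin (λ u → inZero (o u) * inCore x)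
                ≡⟨ cong₂ _+_ size (trans (sumFin-*ʳ (inZero ∘ o) (inCore x)) (*-comm w₀ (inCore x))) ⟩
              suc C + inCore x * w₀ ∎)
      in X , number-map (λ F → v Vector.∷ F) sound (λ _ _ _ _ eq d → eq (suc d)) onto
               (λ { _ _ _ eq eq′ zero → eq zero ; _ _ _ eq eq′ (suc d) → trans (eq (suc d)) (eq′ d) }) count , eq
      where
      sound : ∀ F → Forest S (q ∘ suc) (contract x ∘ o) F → Branch v (v Vector.∷ F)
      sound F (isq , notq , rooted) = refl , (λ { (suc d) → isq d }) , (λ { zero _ → v≢q ; (suc d) → notq d }) ,
        λ { zero → Rooted-expand-zero eq x≢0 rooted ; (suc d) → Rooted-expand eq x≢0 (rooted d) }
      onto : ∀ F → Branch v F → ∃ λ F′ → Forest S (q ∘ suc) (contract x ∘ o) F′ × (F ≗ (v Vector.∷ F′))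
      onto F (refl , isq , notq , rooted) = F ∘ suc ,
        (isq ∘ suc , notq ∘ suc , λ d → Rooted-contract eq (rooted (suc d))) ,
        λ { zero → refl ; (suc d) → refl }

  branch : ∀ v → ∃ λ X → NumberUpTo _≗_ (Branch v) X × X * n ≡ γ v * n ^ outside S
  branch v with v Fin.≟ q zero
  ... | yes refl = 0 , number-empty (λ { F (eq , _ , notq , _) → notq zero refl eq }) , refl
  ... | no v≢q with o v in eq
  ... | nothing = allowed v nothing eq v≢q (λ ()) _ (cong (C +_) (sym (*-identityˡ w₀)))
  ... | just zero = 0 , number-empty (λ { F (refl , _ , _ , rooted) → Rooted-irreflexive (rooted zero) eq }) , refl
  ... | just (suc e) = allowed v (just (suc e)) eq v≢q (λ ()) _ (sym (+-identityʳ C))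

  X : Fin (suc n) → ℕ
  X v = proj₁ (branch v)

-- Summing the forest counts over all sets of colours

sumVec-cong : ∀ {k} {g h : Vec Bool k → ℕ} → (∀ S → g S ≡ h S) → sumVec g ≡ sumVec h
sumVec-cong {zero} eq = eq []
sumVec-cong {suc k} eq = cong₂ _+_ (sumVec-cong (eq ∘ (true ∷_))) (sumVec-cong (eq ∘ (false ∷_)))

sumVec-+ : ∀ {k} (g h : Vec Bool k → ℕ) → sumVec (λ S → g S + h S) ≡ sumVec g + sumVec h
sumVec-+ {zero} g h = refl
sumVec-+ {suc k} g h = trans
  (cong₂ _+_ (sumVec-+ (g ∘ (true ∷_)) (h ∘ (true ∷_))) (sumVec-+ (g ∘ (false ∷_)) (h ∘ (false ∷_))))
  (interchange (sumVec (g ∘ (true ∷_))) _ _ _)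
  where
  interchange : ∀ a b c d → a + b + (c + d) ≡ a + c + (b + d)
  interchange = solve-∀

sumVec-*ˡ : ∀ {k} x (g : Vec Bool k → ℕ) → sumVec (λ S → x * g S) ≡ x * sumVec g
sumVec-*ˡ {zero} x g = refl
sumVec-*ˡ {suc k} x g = trans
  (cong₂ _+_ (sumVec-*ˡ x (g ∘ (true ∷_))) (sumVec-*ˡ x (g ∘ (false ∷_))))
  (sym (*-distribˡ-+ x (sumVec (g ∘ (true ∷_))) _))

sumVec-zero : ∀ {k} {g : Vec Bool k → ℕ} → (∀ S → g S ≡ 0) → sumVec g ≡ 0
sumVec-zero {zero} eq = eq []
sumVec-zero {suc k} eq = cong₂ _+_ (sumVec-zero (eq ∘ (true ∷_))) (sumVec-zero (eq ∘ (false ∷_)))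

mass : ∀ {k} → (Fin k → ℕ) → Vec Bool k → ℕ
mass w [] = 0
mass w (true ∷ S) = w zero + mass (w ∘ suc) S
mass w (false ∷ S) = mass (w ∘ suc) S

inside : ∀ {k} → Vec Bool k → ℕ
inside [] = 0
inside (true ∷ S) = suc (inside S)
inside (false ∷ S) = inside S

is0 is1 is≥2 : ℕ → ℕ
is0 0 = 1
is0 (suc _) = 0
is1 0 = 0
is1 (suc n) = is0 n
is≥2 (suc (suc _)) = 1
is≥2 _ = 0

is-sum : ∀ n → is0 n + (is1 n + is≥2 n) ≡ 1
is-sum 0 = refl
is-sum 1 = refl
is-sum (suc (suc n)) = refl

is0-mass : ∀ {k} (w : Fin k → ℕ) S x → is0 (inside S) * (mass w S * x) ≡ 0
is0-mass w [] x = refl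
is0-mass w (true ∷ S) x = refl
is0-mass w (false ∷ S) x = is0-mass (w ∘ suc) S x

inside≤mass : ∀ {k} (w : Fin k → ℕ) → (∀ c → 1 ≤ w c) → ∀ S → inside S ≤ mass w S
inside≤mass w w≥1 [] = z≤n
inside≤mass w w≥1 (true ∷ S) = +-mono-≤ (w≥1 zero) (inside≤mass (w ∘ suc) (w≥1 ∘ suc) S)
inside≤mass w w≥1 (false ∷ S) = inside≤mass (w ∘ suc) (w≥1 ∘ suc) S

module _ (n : ℕ) where
  open ≡-Reasoning

  private
    pow : ∀ {k} → Vec Bool k → ℕ
    pow S = n ^ outside S

  -- The binomial theorem: each colour contributes 1 if it is in `S` and `n` if it is not.
  sum-pow : ∀ k → sumVec {k} pow ≡ suc n ^ k
  sum-pow zero = refl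
  sum-pow (suc k) = cong₂ _+_ (sum-pow k) (trans (sumVec-*ˡ {k} n pow) (cong (n *_) (sum-pow k)))

  -- For every colour c the sets containing c have total weight (n + 1)^(k - 1), so c contributes
  -- `w c` times that. The extra factor `suc n` avoids the exponent k - 1; the factor `n` in
  -- `sum-is1-mass` and `sum-is1-pow` serves the same purpose.
  sum-mass : ∀ {k} (w : Fin k → ℕ) → sumVec (λ (S : Vec Bool k) → mass w S * pow S) * suc n ≡ sumFin w * suc n ^ k
  sum-mass {zero} w = refl
  sum-mass {suc k} w = begin
    (sumVec (λ (S : Vec Bool k) → (w zero + mass w′ S) * pow S) + sumVec (λ (S : Vec Bool k) → mass w′ S * (n * pow S))) * suc n
      ≡⟨ cong (_* suc n) (cong₂ _+_ (sumVec-cong {k} λ S → *-distribʳ-+ (pow S) (w zero) (mass w′ S))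
                                    (sumVec-cong {k} λ S → swap (mass w′ S) n (pow S))) ⟩
    (sumVec (λ (S : Vec Bool k) → w zero * pow S + mass w′ S * pow S) + sumVec (λ (S : Vec Bool k) → n * (mass w′ S * pow S))) * suc n
      ≡⟨ cong (_* suc n) (cong₂ _+_
           (trans (sumVec-+ (λ (S : Vec Bool k) → w zero * pow S) (λ (S : Vec Bool k) → mass w′ S * pow S))
                  (cong (_+ Q) (trans (sumVec-*ˡ {k} (w zero) pow) (cong (w zero *_) (sum-pow k)))))
           (sumVec-*ˡ n (λ (S : Vec Bool k) → mass w′ S * pow S))) ⟩
    (w zero * suc n ^ k + Q + n * Q) * suc n ≡⟨ regroup (w zero) n (suc n ^ k) Q ⟩
    w zero * suc n ^ suc k + Q * suc n * suc n
      ≡⟨ cong (λ x → w zero * suc n ^ suc k + x * suc n) (sum-mass w′) ⟩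
    w zero * suc n ^ suc k + sumFin w′ * suc n ^ k * suc n ≡⟨ regroup′ (w zero) n (suc n ^ k) (sumFin w′) ⟩
    (w zero + sumFin w′) * suc n ^ suc k ∎
    where
    w′ = w ∘ suc
    Q = sumVec (λ (S : Vec Bool k) → mass w′ S * pow S)
    swap : ∀ a b c → a * (b * c) ≡ b * (a * c)
    swap = solve-∀
    regroup : ∀ a n p q → (a * p + q + n * q) * (1 + n) ≡ a * ((1 + n) * p) + q * (1 + n) * (1 + n)
    regroup = solve-∀
    regroup′ : ∀ a n p b → a * ((1 + n) * p) + b * p * (1 + n) ≡ (a + b) * ((1 + n) * p)
    regroup′ = solve-∀

  sum-is0-pow : ∀ k → sumVec {k} (λ (S : Vec Bool k) → is0 (inside S) * pow S) ≡ n ^ k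
  sum-is0-pow zero = refl
  sum-is0-pow (suc k) = trans
    (cong₂ _+_ (sumVec-zero {k} λ S → refl)
               (trans (sumVec-cong {k} λ S → swap (is0 (inside S)) n (pow S)) (sumVec-*ˡ n λ (S : Vec Bool k) → is0 (inside S) * pow S)))
    (cong (n *_) (sum-is0-pow k))
    where
    swap : ∀ a b c → a * (b * c) ≡ b * (a * c)
    swap = solve-∀

  sum-is1-mass : ∀ {k} (w : Fin k → ℕ) →
    sumVec (λ (S : Vec Bool k) → is1 (inside S) * (mass w S * pow S)) * n ≡ sumFin w * n ^ k
  sum-is1-mass {zero} w = refl
  sum-is1-mass {suc k} w = begin
    (sumVec (λ (S : Vec Bool k) → is0 (inside S) * ((w zero + mass w′ S) * pow S)) +
     sumVec (λ (S : Vec Bool k) → is1 (inside S) * (mass w′ S * (n * pow S)))) * n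
      ≡⟨ cong (_* n) (cong₂ _+_
           (trans (sumVec-cong {k} single) (trans (sumVec-*ˡ (w zero) (λ (S : Vec Bool k) → is0 (inside S) * pow S)) (cong (w zero *_) (sum-is0-pow k))))
           (trans (sumVec-cong {k} λ S → swap (is1 (inside S)) (mass w′ S) n (pow S)) (sumVec-*ˡ n (λ (S : Vec Bool k) → is1 (inside S) * (mass w′ S * pow S))))) ⟩
    (w zero * n ^ k + n * A) * n ≡⟨ regroup (w zero) n (n ^ k) A ⟩
    w zero * n ^ suc k + A * n * n ≡⟨ cong (λ x → w zero * n ^ suc k + x * n) (sum-is1-mass w′) ⟩
    w zero * n ^ suc k + sumFin w′ * n ^ k * n ≡⟨ regroup′ (w zero) n (n ^ k) (sumFin w′) ⟩
    (w zero + sumFin w′) * n ^ suc k ∎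
    where
    w′ = w ∘ suc
    A = sumVec (λ (S : Vec Bool k) → is1 (inside S) * (mass w′ S * pow S))
    expand : ∀ z a b p → z * ((a + b) * p) ≡ a * (z * p) + z * (b * p)
    expand = solve-∀
    single : ∀ S → is0 (inside S) * ((w zero + mass w′ S) * pow S) ≡ w zero * (is0 (inside S) * pow S)
    single S = trans (expand (is0 (inside S)) (w zero) (mass w′ S) (pow S))
                     (trans (cong (w zero * (is0 (inside S) * pow S) +_) (is0-mass w′ S (pow S))) (+-identityʳ _))
    swap : ∀ a b c d → a * (b * (c * d)) ≡ c * (a * (b * d))
    swap = solve-∀
    regroup : ∀ a n p q → (a * p + n * q) * n ≡ a * (n * p) + q * n * n
    regroup = solve-∀
    regroup′ : ∀ a n p b → a * (n * p) + b * p * n ≡ (a + b) * (n * p)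
    regroup′ = solve-∀

  sum-is1-pow : ∀ k → sumVec {k} (λ (S : Vec Bool k) → is1 (inside S) * pow S) * n ≡ k * n ^ k
  sum-is1-pow zero = refl
  sum-is1-pow (suc k) = begin
    (sumVec (λ (S : Vec Bool k) → is0 (inside S) * pow S) + sumVec (λ (S : Vec Bool k) → is1 (inside S) * (n * pow S))) * n
      ≡⟨ cong (_* n) (cong₂ _+_ (sum-is0-pow k)
           (trans (sumVec-cong {k} λ S → swap (is1 (inside S)) n (pow S)) (sumVec-*ˡ n (λ (S : Vec Bool k) → is1 (inside S) * pow S)))) ⟩
    (n ^ k + n * A) * n ≡⟨ regroup n (n ^ k) A ⟩
    n ^ suc k + A * n * n ≡⟨ cong (λ x → n ^ suc k + x * n) (sum-is1-pow k) ⟩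
    n ^ suc k + k * n ^ k * n ≡⟨ regroup′ n (n ^ k) k ⟩
    suc k * n ^ suc k ∎
    where
    A = sumVec (λ (S : Vec Bool k) → is1 (inside S) * pow S)
    swap : ∀ a b c → a * (b * c) ≡ b * (a * c)
    swap = solve-∀
    regroup : ∀ n p q → (p + n * q) * n ≡ n * p + q * n * n
    regroup = solve-∀
    regroup′ : ∀ n p k → n * p + k * p * n ≡ (1 + k) * (n * p)
    regroup′ = solve-∀

  module _ {k : ℕ} (w : Fin k → ℕ) (w≥1 : ∀ c → 1 ≤ w c) (total : sumFin w ≡ suc n) where

    private
      Z = sumVec (λ (S : Vec Bool k) → is≥2 (inside S) * (pred (mass w S) * pow S))
      low = λ (S : Vec Bool k) → is0 (inside S) * pow S
      mid = λ (S : Vec Bool k) → is1 (inside S) * pow S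
      top = λ (S : Vec Bool k) → is≥2 (inside S) * pow S
      mid-mass = λ (S : Vec Bool k) → is1 (inside S) * (mass w S * pow S)
      top-mass = λ (S : Vec Bool k) → is≥2 (inside S) * (mass w S * pow S)

    split : ∀ (g : Vec Bool k → ℕ) S → g S ≡ is0 (inside S) * g S + (is1 (inside S) * g S + is≥2 (inside S) * g S)
    split g S = trans (sym (*-identityˡ (g S))) (trans (cong (_* g S) (sym (is-sum (inside S))))
      (distribute (is0 (inside S)) (is1 (inside S)) (is≥2 (inside S)) (g S)))
      where
      distribute : ∀ a b c x → (a + (b + c)) * x ≡ a * x + (b * x + c * x)
      distribute = solve-∀

    all-pow : suc n ^ k ≡ n ^ k + (sumVec mid + sumVec top)
    all-pow = trans (sym (sum-pow k)) (trans (sumVec-cong {k} (split pow)) (trans (sumVec-+ low (λ (S : Vec Bool k) → mid S + top S))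
      (cong₂ _+_ (sum-is0-pow k) (sumVec-+ mid top))))

    -- As `sumFin w` is n + 1, it cancels the spare factor of `sum-mass` and leaves the same power
    -- as in `all-pow`.
    all-mass : suc n ^ k ≡ sumVec mid-mass + sumVec top-mass
    all-mass = trans (sym (*-cancelʳ-≡ _ _ (suc n) (trans (sum-mass w) (trans (cong (_* suc n ^ k) total) (*-comm (suc n) _)))))
      (trans (sumVec-cong {k} λ S → trans (split (λ (S : Vec Bool k) → mass w S * pow S) S)
                (cong (_+ (mid-mass S + top-mass S)) (is0-mass w S (pow S))))
             (sumVec-+ mid-mass top-mass))

    -- For |S| ≥ 2 the mass is positive, so `pred` really subtracts one.
    drop-one : ∀ S → is≥2 (inside S) * (pred (mass w S) * pow S) + top S ≡ top-mass S
    drop-one S with inside S | inside≤mass w w≥1 S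
    ... | 0 | _ = refl
    ... | 1 | _ = refl
    ... | suc (suc i) | le with mass w S
    ... | suc m = collect m (pow S)
      where
      collect : ∀ m p → m * p + 0 + (p + 0) ≡ p + m * p + 0
      collect = solve-∀

    -- Without the restriction to |S| ≥ 2 the two sums ∑ mass·n^|Sᶜ| and ∑ n^|Sᶜ| agree, so only the
    -- terms with |S| ≤ 1 survive.
    sum-top : Z * n + n ^ k ≡ k * n ^ k
    sum-top = +-cancelʳ-≡ (n * n ^ k) _ _ (begin
      Z * n + n ^ k + n * n ^ k ≡⟨ regroup Z n (n ^ k) ⟩
      Z * n + suc n * n ^ k ≡⟨ cong (λ x → Z * n + x * n ^ k) total ⟨
      Z * n + sumFin w * n ^ k ≡⟨ cong (Z * n +_) (sum-is1-mass w) ⟨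
      Z * n + sumVec mid-mass * n ≡⟨ *-distribʳ-+ n Z (sumVec mid-mass) ⟨
      (Z + sumVec mid-mass) * n ≡⟨ cong (_* n) key ⟩
      (n ^ k + sumVec mid) * n ≡⟨ *-distribʳ-+ n (n ^ k) (sumVec mid) ⟩
      n ^ k * n + sumVec mid * n ≡⟨ cong₂ _+_ (*-comm (n ^ k) n) (sum-is1-pow k) ⟩
      n * n ^ k + k * n ^ k ≡⟨ +-comm (n * n ^ k) _ ⟩
      k * n ^ k + n * n ^ k ∎)
      where
      regroup : ∀ z n p → z * n + p + n * p ≡ z * n + (1 + n) * p
      regroup = solve-∀
      rotate : ∀ a b c → a + b + c ≡ b + (a + c)
      rotate = solve-∀
      key : Z + sumVec mid-mass ≡ n ^ k + sumVec mid
      key = +-cancelʳ-≡ (sumVec top) _ _ (begin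
        Z + sumVec mid-mass + sumVec top ≡⟨ rotate Z (sumVec mid-mass) (sumVec top) ⟩
        sumVec mid-mass + (Z + sumVec top)
          ≡⟨ cong (sumVec mid-mass +_) (trans (sym (sumVec-+ (λ (S : Vec Bool k) → is≥2 (inside S) * (pred (mass w S) * pow S)) top)) (sumVec-cong drop-one)) ⟩
        sumVec mid-mass + sumVec top-mass ≡⟨ all-mass ⟨
        suc n ^ k ≡⟨ all-pow ⟩
        n ^ k + (sumVec mid + sumVec top) ≡⟨ +-assoc (n ^ k) _ _ ⟨
        n ^ k + sumVec mid + sumVec top ∎)

sum-forests : ∀ n k (w : Fin (suc (suc k)) → ℕ) → .{{_ : NonZero n}} → (∀ c → 1 ≤ w c) → sumFin w ≡ suc n →
  (X : Vec Bool (suc (suc k)) → ℕ) →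
  (∀ S → X S * n ≡ is≥2 (inside S) * (pred (mass w S) * n ^ outside S)) →
  sumVec X ≡ suc k * n ^ k
sum-forests n k w w≥1 total X eq =
  -- One factor `n` belongs to the counts `X S * n`, the other to `sum-top`; the added power turns k
  -- + 1 into the k + 2 of `sum-top`.
  *-cancelʳ-≡ _ _ n (*-cancelʳ-≡ _ _ n (+-cancelʳ-≡ (n ^ suc (suc k)) _ _ (begin
    sumVec X * n * n + n ^ suc (suc k) ≡⟨ cong (λ x → x * n + n ^ suc (suc k)) X*n ⟩
    sumVec (λ (S : Vec Bool (suc (suc k))) → is≥2 (inside S) * (pred (mass w S) * n ^ outside S)) * n + n ^ suc (suc k)
      ≡⟨ sum-top n w w≥1 total ⟩
    suc (suc k) * n ^ suc (suc k) ≡⟨ regroup n k (n ^ k) ⟩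
    suc k * n ^ k * n * n + n ^ suc (suc k) ∎)))
  where
  open ≡-Reasoning
  X*n : sumVec X * n ≡ sumVec (λ (S : Vec Bool (suc (suc k))) → is≥2 (inside S) * (pred (mass w S) * n ^ outside S))
  X*n = trans (*-comm (sumVec X) n) (trans (sym (sumVec-*ˡ n X)) (sumVec-cong {suc (suc k)} λ S → trans (*-comm n (X S)) (eq S)))
  regroup : ∀ n k p → (2 + k) * (n * (n * p)) ≡ (1 + k) * p * n * n + n * (n * p)
  regroup = solve-∀

-- The cyclic order of colours

-- Number of steps from a up to x around the cycle, with values in 1 , … , k (so δ a a ≡ k).
δ : ∀ {k} → Fin k → Fin k → ℕ
δ {k} a x with toℕ a <? toℕ x
... | yes _ = toℕ x ∸ toℕ a
... | no _ = toℕ x + k ∸ toℕ a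

module _ {k : ℕ} where

  δ-< : (a x : Fin k) → toℕ a < toℕ x → δ a x + toℕ a ≡ toℕ x
  δ-< a x a<x with toℕ a <? toℕ x
  ... | yes _ = m∸n+n≡m (<⇒≤ a<x)
  ... | no a≮x = contradiction a<x a≮x

  δ-≥ : (a x : Fin k) → toℕ x ≤ toℕ a → δ a x + toℕ a ≡ toℕ x + k
  δ-≥ a x x≤a with toℕ a <? toℕ x
  ... | yes a<x = contradiction a<x (≤⇒≯ x≤a)
  ... | no _ = m∸n+n≡m (≤-trans (<⇒≤ (Fin.toℕ<n a)) (m≤n+m k (toℕ x)))

  -- The representative of x - a modulo k in the range 1, ..., k. Unlike `δ` it involves no
  -- comparison of `a` with `x`, so it can be checked for sums and differences of distances.
  IsDistance : Fin k → Fin k → ℕ → Set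
  IsDistance a x t = 1 ≤ t × t ≤ k × (t + toℕ a ≡ toℕ x ⊎ t + toℕ a ≡ toℕ x + k)

  δ-isDistance : ∀ a x → IsDistance a x (δ a x)
  δ-isDistance a x with toℕ a <? toℕ x
  ... | yes a<x = m<n⇒0<n∸m a<x , ≤-trans (m∸n≤m (toℕ x) (toℕ a)) (<⇒≤ (Fin.toℕ<n x)) , inj₁ (m∸n+n≡m (<⇒≤ a<x))
  ... | no a≮x = m<n⇒0<n∸m (≤-trans (Fin.toℕ<n a) (m≤n+m k (toℕ x))) ,
    m≤n+o⇒m∸n≤o (toℕ x + k) (toℕ a) (+-monoˡ-≤ k (≮⇒≥ a≮x)) ,
    inj₂ (m∸n+n≡m (≤-trans (<⇒≤ (Fin.toℕ<n a)) (m≤n+m k (toℕ x))))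

  private
    wraps : ∀ {a x s t} → s ≤ k → 1 ≤ t → t + a ≡ x → s + a ≡ x + k → ⊥
    wraps {a} {x} {s} {t} s≤k 1≤t refl eq = <⇒≱ (begin-strict
      s ≤⟨ s≤k ⟩ k <⟨ +-monoˡ-≤ k 1≤t ⟩ t + k ∎)
      (≤-reflexive (+-cancelʳ-≡ a _ _ (trans (regroup t k a) (sym eq))))
      where
      open ≤-Reasoning
      regroup : ∀ t k a → t + k + a ≡ t + a + k
      regroup = solve-∀

  distance-unique : ∀ {a x s t} → IsDistance a x s → IsDistance a x t → s ≡ t
  distance-unique {a} (_ , _ , inj₁ p) (_ , _ , inj₁ q) = +-cancelʳ-≡ (toℕ a) _ _ (trans p (sym q))
  distance-unique {a} (_ , _ , inj₂ p) (_ , _ , inj₂ q) = +-cancelʳ-≡ (toℕ a) _ _ (trans p (sym q))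
  distance-unique (1≤s , _ , inj₁ p) (_ , t≤k , inj₂ q) = ⊥-elim (wraps t≤k 1≤s p q)
  distance-unique (_ , s≤k , inj₂ p) (1≤t , _ , inj₁ q) = ⊥-elim (wraps s≤k 1≤t q p)

  δ-self : ∀ (a x : Fin k) → δ a x ≤ δ a a
  δ-self a x = subst (δ a x ≤_) (+-cancelʳ-≡ (toℕ a) _ _ (trans (+-comm k _) (sym (δ-≥ a a ≤-refl))))
                     (proj₁ (proj₂ (δ-isDistance a x)))

  δ-selfˡ : ∀ (a x : Fin k) → δ x a ≤ δ a a
  δ-selfˡ a x = subst (δ x a ≤_) (+-cancelʳ-≡ (toℕ a) _ _ (trans (+-comm k _) (sym (δ-≥ a a ≤-refl))))
                      (proj₁ (proj₂ (δ-isDistance x a)))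

  private
    far : ∀ {x y : Fin k} → ¬ (toℕ y ≡ toℕ x + k)
    far {x} {y} eq = <⇒≱ (Fin.toℕ<n y) (≤-trans (m≤n+m k (toℕ x)) (≤-reflexive (sym eq)))

  δ-injectiveʳ : ∀ (a : Fin k) {x y} → δ a x ≡ δ a y → x ≡ y
  δ-injectiveʳ a {x} {y} eq with proj₂ (proj₂ (δ-isDistance a x)) | proj₂ (proj₂ (δ-isDistance a y))
  ... | inj₁ p | inj₁ q = Fin.toℕ-injective (trans (sym p) (trans (cong (_+ toℕ a) eq) q))
  ... | inj₂ p | inj₂ q = Fin.toℕ-injective (+-cancelʳ-≡ k _ _ (trans (sym p) (trans (cong (_+ toℕ a) eq) q)))
  ... | inj₁ p | inj₂ q = ⊥-elim (far (trans (sym p) (trans (cong (_+ toℕ a) eq) q)))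
  ... | inj₂ p | inj₁ q = ⊥-elim (far (trans (sym q) (trans (cong (_+ toℕ a) (sym eq)) p)))

  δ-injectiveˡ : ∀ (b : Fin k) {x y} → δ x b ≡ δ y b → x ≡ y
  δ-injectiveˡ b {x} {y} eq with proj₂ (proj₂ (δ-isDistance x b)) | proj₂ (proj₂ (δ-isDistance y b))
  ... | inj₁ p | inj₁ q = Fin.toℕ-injective (+-cancelˡ-≡ (δ x b) _ _ (trans p (trans (sym q) (cong (_+ toℕ y) (sym eq)))))
  ... | inj₂ p | inj₂ q = Fin.toℕ-injective (+-cancelˡ-≡ (δ x b) _ _ (trans p (trans (sym q) (cong (_+ toℕ y) (sym eq)))))
  ... | inj₁ p | inj₂ q = ⊥-elim (far (+-cancelˡ-≡ (δ y b) _ _ (trans q (trans (cong (_+ k) (trans (sym p) (cong (_+ toℕ x) eq))) (+-assoc (δ y b) _ k)))))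
  ... | inj₂ p | inj₁ q = ⊥-elim (far (+-cancelˡ-≡ (δ x b) _ _ (trans p (trans (cong (_+ k) (trans (sym q) (cong (_+ toℕ y) (sym eq)))) (+-assoc (δ x b) _ k)))))

  private
    swap : ∀ a b c → a + b + c ≡ b + (a + c)
    swap = solve-∀

    -- Distances add along the cycle. A wrap before `x` without a wrap on the way to `b` would give
    -- `b` a number of at least k.
    remaining : ∀ {a x b : Fin k} {t} u s → u + s ≡ t →
      (u + toℕ a ≡ toℕ x ⊎ u + toℕ a ≡ toℕ x + k) → (t + toℕ a ≡ toℕ b ⊎ t + toℕ a ≡ toℕ b + k) →
      s + toℕ x ≡ toℕ b ⊎ s + toℕ x ≡ toℕ b + k
    remaining {a} {x} {b} u s refl (inj₁ p) tb rewrite sym p | sym (swap u s (toℕ a)) = tb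
    remaining {a} {x} {b} u s refl (inj₂ p) (inj₁ q) = ⊥-elim (<⇒≱ (Fin.toℕ<n b) (begin
      k ≤⟨ m≤n+m k (s + toℕ x) ⟩ s + toℕ x + k ≡⟨ +-assoc s _ k ⟩ s + (toℕ x + k) ≡⟨ cong (s +_) p ⟨
      s + (u + toℕ a) ≡⟨ swap u s (toℕ a) ⟨ u + s + toℕ a ≡⟨ q ⟩ toℕ b ∎))
      where open ≤-Reasoning
    remaining {a} {x} {b} u s refl (inj₂ p) (inj₂ q) = inj₁ (+-cancelʳ-≡ k _ _
      (trans (+-assoc s _ k) (trans (cong (s +_) (sym p)) (trans (sym (swap u s (toℕ a))) q))))

    elapsed : ∀ {a x b : Fin k} {t} u s → u + s ≡ t →
      (s + toℕ x ≡ toℕ b ⊎ s + toℕ x ≡ toℕ b + k) → (t + toℕ a ≡ toℕ b ⊎ t + toℕ a ≡ toℕ b + k) →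
      u + toℕ a ≡ toℕ x ⊎ u + toℕ a ≡ toℕ x + k
    elapsed {a} {x} {b} u s refl (inj₁ p) (inj₁ q) =
      inj₁ (+-cancelˡ-≡ s _ _ (trans (sym (swap u s (toℕ a))) (trans q (sym p))))
    elapsed {a} {x} {b} u s refl (inj₂ p) (inj₂ q) =
      inj₁ (+-cancelˡ-≡ s _ _ (trans (sym (swap u s (toℕ a))) (trans q (sym p))))
    elapsed {a} {x} {b} u s refl (inj₁ p) (inj₂ q) =
      inj₂ (+-cancelˡ-≡ s _ _ (trans (sym (swap u s (toℕ a))) (trans q (trans (cong (_+ k) (sym p)) (+-assoc s _ k)))))
    elapsed {a} {x} {b} u s refl (inj₂ p) (inj₁ q) = ⊥-elim (<⇒≱ (Fin.toℕ<n x) (begin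
      k ≤⟨ m≤n+m k (u + toℕ a) ⟩ u + toℕ a + k
        ≡⟨ +-cancelˡ-≡ s _ _ (trans (sym (+-assoc s _ k)) (trans (cong (_+ k) (trans (sym (swap u s (toℕ a))) q)) (sym p))) ⟩
      toℕ x ∎))
      where open ≤-Reasoning

  -- Both sides say that x lies strictly between a and b.
  δ-betweenʳ : ∀ (a x b : Fin k) → δ a x < δ a b → δ x b < δ a b
  δ-betweenʳ a x b lt with δ-isDistance a x | δ-isDistance a b
  ... | 1≤u , _ , du | _ , t≤k , dt =
    subst (_< δ a b) (distance-unique (m<n⇒0<n∸m lt , ≤-trans (m∸n≤m (δ a b) (δ a x)) t≤k ,
        remaining {a = a} (δ a x) (δ a b ∸ δ a x) (m+[n∸m]≡n (<⇒≤ lt)) du dt) (δ-isDistance x b))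
      (∸-monoʳ-< 1≤u (<⇒≤ lt))

  δ-betweenˡ : ∀ (a x b : Fin k) → δ x b < δ a b → δ a x < δ a b
  δ-betweenˡ a x b lt with δ-isDistance x b | δ-isDistance a b
  ... | 1≤s , _ , ds | _ , t≤k , dt =
    subst (_< δ a b) (distance-unique (m<n⇒0<n∸m lt , ≤-trans (m∸n≤m (δ a b) (δ x b)) t≤k ,
        elapsed {a = a} (δ a b ∸ δ x b) (δ x b) (m∸n+n≡m (<⇒≤ lt)) ds dt) (δ-isDistance a x))
      (∸-monoʳ-< 1≤s (<⇒≤ lt))

  module _ {ℓ : Fin k → ℕ} {m : ℕ} (f : Gluing k ℓ m) where

    -- The four cases of the definition become one comparison. For b ≡ a the bound `δ a a` is k, the
    -- largest distance, so exactly the colours other than `a` lie in between.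
    CycBetween⇒δ : ∀ a x b → CycBetween f a x b → δ a x < δ a b
    CycBetween⇒δ a x b (inj₁ (a<b , a<x , x<b)) =
      +-cancelʳ-< (toℕ a) _ _ (subst₂ _<_ (sym (δ-< a x a<x)) (sym (δ-< a b a<b)) x<b)
    CycBetween⇒δ a x b (inj₂ (b≤a , inj₁ a<x)) =
      +-cancelʳ-< (toℕ a) _ _ (subst₂ _<_ (sym (δ-< a x a<x)) (sym (δ-≥ a b b≤a)) (≤-trans (Fin.toℕ<n x) (m≤n+m k _)))
    CycBetween⇒δ a x b (inj₂ (b≤a , inj₂ x<b)) =
      +-cancelʳ-< (toℕ a) _ _ (subst₂ _<_ (sym (δ-≥ a x (<⇒≤ (<-≤-trans x<b b≤a)))) (sym (δ-≥ a b b≤a)) (+-monoˡ-< k x<b))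

    δ⇒CycBetween : ∀ a x b → δ a x < δ a b → CycBetween f a x b
    δ⇒CycBetween a x b lt with <-≤-connex (toℕ a) (toℕ x) | <-≤-connex (toℕ a) (toℕ b) | +-monoˡ-< (toℕ a) lt
    ... | inj₁ a<x | inj₁ a<b | lt′ = inj₁ (a<b , a<x , subst₂ _<_ (δ-< a x a<x) (δ-< a b a<b) lt′)
    ... | inj₁ a<x | inj₂ b≤a | lt′ = inj₂ (b≤a , inj₁ a<x)
    ... | inj₂ x≤a | inj₂ b≤a | lt′ =
      inj₂ (b≤a , inj₂ (+-cancelʳ-< k _ _ (subst₂ _<_ (δ-≥ a x x≤a) (δ-≥ a b b≤a) lt′)))
    ... | inj₂ x≤a | inj₁ a<b | lt′ =
      contradiction (<-trans (subst₂ _<_ (δ-≥ a x x≤a) (δ-< a b a<b) lt′) (Fin.toℕ<n b)) (≤⇒≯ (m≤n+m k (toℕ x)))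

argmin : ∀ {k} {P : Fin k → Set} → Decidable P → (g : Fin k → ℕ) → ∃ P →
         ∃ λ p → P p × (∀ x → P x → g p ≤ g x)
argmin {suc k} {P} P? g (y , Py) with Fin.any? (P? ∘ suc) | P? zero
... | no none | _ with y
...   | zero = zero , Py , λ { zero _ → ≤-refl ; (suc x) Px → contradiction (x , Px) none }
...   | suc y′ = contradiction (y′ , Py) none
argmin {suc k} {P} P? g (y , Py) | yes some | P₀? with argmin (P? ∘ suc) (g ∘ suc) some
... | p , Pp , min with P₀?
...   | no ¬P₀ = suc p , Pp , λ { zero P₀ → contradiction P₀ ¬P₀ ; (suc x) → min x }
...   | yes P₀ with ≤-total (g zero) (g (suc p))
...     | inj₁ le = zero , P₀ , λ { zero _ → ≤-refl ; (suc x) Px → ≤-trans le (min x Px) }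
...     | inj₂ ge = suc p , Pp , λ { zero _ → ge ; (suc x) → min x }

-- Corners of a polygon

toℕ-addMod : ∀ {l} (i : Fin (suc l)) r → toℕ (addMod i r) ≡ (toℕ i + r) % suc l
toℕ-addMod {l} i r = Fin.toℕ-fromℕ< (m%n<n (toℕ i + r) (suc l))

addMod-+ : ∀ {l} (i : Fin l) r s → addMod (addMod i r) s ≡ addMod i (r + s)
addMod-+ {suc l} i r s = Fin.toℕ-injective (begin
  toℕ (addMod (addMod i r) s) ≡⟨ toℕ-addMod (addMod i r) s ⟩
  (toℕ (addMod i r) + s) % suc l ≡⟨ cong (λ x → (x + s) % suc l) (toℕ-addMod i r) ⟩
  ((toℕ i + r) % suc l + s) % suc l ≡⟨ %-distribˡ-+ ((toℕ i + r) % suc l) s (suc l) ⟩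
  ((toℕ i + r) % suc l % suc l + s % suc l) % suc l ≡⟨ cong (λ x → (x + s % suc l) % suc l) (m%n%n≡m%n (toℕ i + r) (suc l)) ⟩
  ((toℕ i + r) % suc l + s % suc l) % suc l ≡⟨ %-distribˡ-+ (toℕ i + r) s (suc l) ⟨
  (toℕ i + r + s) % suc l ≡⟨ cong (_% suc l) (+-assoc (toℕ i) r s) ⟩
  (toℕ i + (r + s)) % suc l ≡⟨ toℕ-addMod i (r + s) ⟨
  toℕ (addMod i (r + s)) ∎)
  where open ≡-Reasoning

addMod-comm : ∀ {l} (i : Fin l) r s → addMod (addMod i r) s ≡ addMod (addMod i s) r
addMod-comm i r s = trans (addMod-+ i r s) (trans (cong (addMod i) (+-comm r s)) (sym (addMod-+ i s r)))

addMod-* : ∀ {l} (i : Fin l) r → addMod i (r * l) ≡ i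
addMod-* {suc l} i r = Fin.toℕ-injective (trans (toℕ-addMod i (r * suc l))
  (trans ([m+kn]%n≡m%n (toℕ i) r (suc l)) (m<n⇒m%n≡m (Fin.toℕ<n i))))

-- r + r * (l - 1) = r * l is a number of full turns, so rotations are undone without subtraction.
addMod-inverse : ∀ {l} (i : Fin l) r → addMod (addMod i r) (r * pred l) ≡ i
addMod-inverse {suc l} i r = trans (addMod-+ i r (r * l)) (trans (cong (addMod i) (sym (*-suc r l))) (addMod-* i r))

addMod-injective : ∀ {l} {i j : Fin l} r → addMod i r ≡ addMod j r → i ≡ j
addMod-injective {l} {i} {j} r eq = trans (sym (addMod-inverse i r)) (trans (cong (λ x → addMod x (r * pred l)) eq) (addMod-inverse j r))

base : ∀ {l} → 2 ≤ l → Fin l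
base (s≤s _) = zero

first : ∀ {l} → 2 ≤ l → Fin (pred l)
first (s≤s (s≤s _)) = zero

nonbase : ∀ {l} → Fin (pred l) → Fin l
nonbase {suc l} p = suc p

nonbase-injective : ∀ {l} {p p′ : Fin (pred l)} → nonbase {l} p ≡ nonbase {l} p′ → p ≡ p′
nonbase-injective {suc l} = Fin.suc-injective

base≢nonbase : ∀ {l} (l≥2 : 2 ≤ l) {p} → ¬ (base l≥2 ≡ nonbase p)
base≢nonbase (s≤s _) ()

corner-view : ∀ {l} (l≥2 : 2 ≤ l) j → j ≡ base l≥2 ⊎ ∃ λ p → j ≡ nonbase p
corner-view (s≤s _) zero = inj₁ refl
corner-view (s≤s _) (suc p) = inj₂ (p , refl)

addMod-base : ∀ {l} (l≥2 : 2 ≤ l) j → addMod (base l≥2) (toℕ j) ≡ j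
addMod-base {suc l} (s≤s _) j =
  Fin.toℕ-injective (trans (toℕ-addMod {l} zero (toℕ j)) (m<n⇒m%n≡m (Fin.toℕ<n j)))

toℕ-nonbase : ∀ {l} (p : Fin (pred l)) → toℕ (nonbase {l} p) ≡ suc (toℕ p)
toℕ-nonbase {suc l} p = refl

toℕ-first : ∀ {l} (l≥2 : 2 ≤ l) → toℕ (first l≥2) ≡ 0
toℕ-first (s≤s (s≤s _)) = refl

module _ {l : ℕ} (l≥2 : 2 ≤ l) where

  addMod-base-suc : ∀ p → addMod (base l≥2) (suc (toℕ p)) ≡ nonbase p
  addMod-base-suc p = trans (cong (addMod (base l≥2)) (sym (toℕ-nonbase p))) (addMod-base l≥2 (nonbase p))

  sucMod-base : sucMod (base l≥2) ≡ nonbase (first l≥2)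
  sucMod-base = trans (cong (λ x → addMod (base l≥2) (suc x)) (sym (toℕ-first l≥2))) (addMod-base-suc (first l≥2))

  rotate-to-base : ∀ i → ∃ λ r → addMod i r ≡ base l≥2
  rotate-to-base i = toℕ i * pred l , trans (cong (λ x → addMod x (toℕ i * pred l)) (sym (addMod-base l≥2 i))) (addMod-inverse (base l≥2) (toℕ i))

  sucMod-≢ : ∀ (j : Fin l) → ¬ (sucMod j ≡ j)
  sucMod-≢ j eq = base≢nonbase l≥2 (trans (sym (proj₂ (rotate-to-base j)))
    (trans (cong (λ x → addMod x (proj₁ (rotate-to-base j))) (sym eq))
    (trans (addMod-comm j 1 _) (trans (cong sucMod (proj₂ (rotate-to-base j))) sucMod-base))))

  sucMod-induction : (P : Fin l → Set) {i : Fin l} → P i → (∀ j → P j → P (sucMod j)) → ∀ j → P j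
  sucMod-induction P {i} Pi Psuc j = subst P
    (trans (sym (addMod-+ i r (toℕ j))) (trans (cong (λ x → addMod x (toℕ j)) eq) (addMod-base l≥2 j)))
    (go (r + toℕ j))
    where
    r = proj₁ (rotate-to-base i)
    eq = proj₂ (rotate-to-base i)
    go : ∀ t → P (addMod i t)
    go zero = subst P (sym (addMod-* i 0)) Pi
    go (suc t) = subst P (trans (addMod-+ i t 1) (cong (addMod i) (+-comm t 1))) (Psuc _ (go t))

-- The walk runs from corner 2 up to corner 0, which it reaches as corner l, so it never steps on
-- from the base or from corner 1. It is the part of a polygon of the small cycle that the large
-- face follows.
sucMod-induction-after-first : ∀ {l} (l≥2 : 2 ≤ l) (P : Fin l → Set) → P (sucMod (nonbase (first l≥2))) →
  (∀ p → ¬ (p ≡ first l≥2) → P (nonbase p) → P (sucMod (nonbase p))) → ∀ j → ¬ (j ≡ nonbase (first l≥2)) → P j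
sucMod-induction-after-first {suc (suc u)} l≥2@(s≤s (s≤s z≤n)) P P₂ Psuc = λ
  { zero _ → subst P (Fin.toℕ-injective (trans (toℕ-addMod {suc u} zero (suc (suc u))) (n%n≡0 (suc (suc u))))) (go u ≤-refl)
  ; (suc zero) ne → contradiction refl ne
  ; (suc (suc j)) _ → subst P (addMod-base l≥2 (suc (suc j))) (go (toℕ j) (<⇒≤ (Fin.toℕ<n j))) }
  where
  go : ∀ t → t ≤ u → P (addMod {suc (suc u)} zero (suc (suc t)))
  go zero _ = P₂
  go (suc t) t<u = subst P (trans (cong sucMod (sym p-eq)) (trans (addMod-+ {suc (suc u)} zero (suc (suc t)) 1) (cong (addMod zero) (+-comm (suc (suc t)) 1))))
    (Psuc p p≢0 (subst P p-eq (go t (<⇒≤ t<u))))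
    where
    p : Fin (suc u)
    p = suc (fromℕ< t<u)
    p≢0 : ¬ (p ≡ zero)
    p≢0 ()
    p-eq : addMod {suc (suc u)} zero (suc (suc t)) ≡ suc p
    p-eq = trans (cong (λ x → addMod zero (suc (suc x))) (sym (Fin.toℕ-fromℕ< t<u))) (addMod-base l≥2 (suc p))

sucMod-induction-nonbase : ∀ {l} (l≥2 : 2 ≤ l) (P : Fin l → Set) → P (nonbase (first l≥2)) →
  (∀ p → P (nonbase p) → P (sucMod (nonbase p))) → ∀ j → P j
sucMod-induction-nonbase l≥2 P P₁ Psuc j with j Fin.≟ nonbase (first l≥2)
... | yes refl = P₁
... | no ne = sucMod-induction-after-first l≥2 P (Psuc _ P₁) (λ p _ → Psuc p) j ne

-- Gluings in normal form

encodeTo : ∀ {k m} (w : Fin k → ℕ) → sumFin w ≡ m → Σ (Fin k) (Fin ∘ w) → Fin m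
encodeTo w refl = encode w

decodeTo : ∀ {k m} (w : Fin k → ℕ) → sumFin w ≡ m → Fin m → Σ (Fin k) (Fin ∘ w)
decodeTo w refl = decode w

decodeTo-encodeTo : ∀ {k m} (w : Fin k → ℕ) (eq : sumFin w ≡ m) x → decodeTo w eq (encodeTo w eq x) ≡ x
decodeTo-encodeTo w refl = decode-encode w

encodeTo-decodeTo : ∀ {k m} (w : Fin k → ℕ) (eq : sumFin w ≡ m) v → encodeTo w eq (decodeTo w eq v) ≡ v
encodeTo-decodeTo w refl = encode-decode w

bool-cases : ∀ b → b ≡ true ⊎ b ≡ false
bool-cases true = inj₁ refl
bool-cases false = inj₂ refl

true≢false : ∀ {b} → b ≡ true → ¬ (b ≡ false)
true≢false refl ()

iterate : {A : Set} → (A → A) → ℕ → A → A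
iterate h zero x = x
iterate h (suc t) x = h (iterate h t x)

iterate-suc : {A : Set} (h : A → A) → ∀ t x → iterate h (suc t) x ≡ iterate h t (h x)
iterate-suc h zero x = refl
iterate-suc h (suc t) x = cong h (iterate-suc h t x)

uniform-bound : ∀ {k} {Q : ℕ → Fin k → Set} → (∀ t d → Q t d → Q (suc t) d) → (∀ d → ∃ λ t → Q t d) → ∃ λ T → ∀ d → Q T d
uniform-bound {zero} _ _ = 0 , λ ()
uniform-bound {suc k} {Q} up each with each zero | uniform-bound {k} {λ t d → Q t (suc d)} (λ t d → up t (suc d)) (each ∘ suc)
... | t , q | T , qs = t + T , λ { zero → subst (λ x → Q x zero) (+-comm T t) (lift T q) ; (suc d) → lift t (qs d) }
  where
  lift : ∀ s {t d} → Q t d → Q (s + t) d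
  lift zero q = q
  lift (suc s) q = up _ _ (lift s q)

module Normal {k : ℕ} (ℓ : Fin k → ℕ) (ℓ≥2 : ∀ c → 2 ≤ ℓ c) {m : ℕ} (total : sumFin (pred ∘ ℓ) ≡ m) where

  vertex : (c : Fin k) → Fin (pred (ℓ c)) → Fin m
  vertex c p = encodeTo (pred ∘ ℓ) total (c , p)

  owner : Fin m → Fin k
  owner v = proj₁ (decodeTo (pred ∘ ℓ) total v)

  place : ∀ v → Fin (pred (ℓ (owner v)))
  place v = proj₂ (decodeTo (pred ∘ ℓ) total v)

  vertex-owner : ∀ v → vertex (owner v) (place v) ≡ v
  vertex-owner = encodeTo-decodeTo (pred ∘ ℓ) total

  owner-vertex : ∀ c p → owner (vertex c p) ≡ c
  owner-vertex c p = cong proj₁ (decodeTo-encodeTo (pred ∘ ℓ) total (c , p))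

  vertex-≡ : ∀ {c p c′ p′} → vertex c p ≡ vertex c′ p′ → (c , p) ≡ (c′ , p′)
  vertex-≡ eq = trans (sym (decodeTo-encodeTo (pred ∘ ℓ) total _))
    (trans (cong (decodeTo (pred ∘ ℓ) total) eq) (decodeTo-encodeTo (pred ∘ ℓ) total _))

  vertex-injective : ∀ {c p p′} → vertex c p ≡ vertex c p′ → p ≡ p′
  vertex-injective eq with refl ← vertex-≡ eq = refl

  start : ∀ c → Fin (ℓ c)
  start c = base (ℓ≥2 c)

  next₁ : ∀ c → Fin (pred (ℓ c))
  next₁ c = first (ℓ≥2 c)

  -- Every vertex is a non-base corner of exactly one polygon, and F says where the base corners go.
  glue : (Fin k → Fin m) → Gluing k ℓ m
  glue F c j = [ (λ _ → F c) , (λ (p , _) → vertex c p) ]′ (corner-view (ℓ≥2 c) j)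

  glue-base : ∀ F c → glue F c (start c) ≡ F c
  glue-base F c with corner-view (ℓ≥2 c) (start c)
  ... | inj₁ _ = refl
  ... | inj₂ (p , eq) = contradiction eq (base≢nonbase (ℓ≥2 c))

  glue-nonbase : ∀ F c p → glue F c (nonbase p) ≡ vertex c p
  glue-nonbase F c p with corner-view (ℓ≥2 c) (nonbase p)
  ... | inj₁ eq = contradiction (sym eq) (base≢nonbase (ℓ≥2 c))
  ... | inj₂ (p′ , eq) = cong (vertex c) (sym (nonbase-injective {ℓ c} eq))

  -- The grouping to which `forest-count` is applied: the polygons of `S` share the core, so a
  -- colour of `S` has an empty block of its own.
  block : (Fin k → Bool) → Fin m → Maybe (Fin k)
  block S v = if S (owner v) then nothing else just (owner v)

  block-nothing : ∀ S v → block S v ≡ nothing → S (owner v) ≡ true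
  block-nothing S v eq with S (owner v)
  ... | true = refl

  block-just : ∀ S v {e} → block S v ≡ just e → owner v ≡ e × S e ≡ false
  block-just S v eq with S (owner v) in eq′
  block-just S v refl | false = refl , eq′

  -- The codes of constellations with small cycle `S`. At the vertex named in `F-∉` the small face
  -- turns from the polygon `before d` to the next one of `S`, and the colour `d` lies between these
  -- two. A polygon `d` attached there would sit inside the small face and become part of it.
  record Good (S : Fin k → Bool) (F : Fin k → Fin m) : Set where
    field
      two : ∃₂ λ a b → S a ≡ true × S b ≡ true × ¬ (a ≡ b)
      before : Fin k → Fin k
      before-∈ : ∀ d → S (before d) ≡ true
      before-min : ∀ d x → S x ≡ true → δ (before d) d ≤ δ x d
      F-∈ : ∀ d → S d ≡ true → F d ≡ vertex (before d) (next₁ (before d))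
      F-∉ : ∀ d → S d ≡ false → ¬ (F d ≡ vertex (before d) (next₁ (before d)))
      rooted : ∀ d → Rooted (block S) F d

    parent : Fin k → Fin k
    parent d = owner (F d)

    -- If `before d` were not `c`, it would be closer to `d`, hence strictly between `c` and `d`,
    -- against `min`.
    sector : ∀ {c d} → S c ≡ true → (∀ x → S x ≡ true → δ c d ≤ δ c x) → before d ≡ c
    sector {c} {d} c∈S min with before d Fin.≟ c
    ... | yes eq = eq
    ... | no ne = contradiction (min (before d) (before-∈ d))
      (<⇒≱ (δ-betweenˡ c (before d) d (≤∧≢⇒< (before-min d c c∈S) (ne ∘ δ-injectiveˡ d))))

    before-sector : ∀ d x → S x ≡ true → δ (before d) d ≤ δ (before d) x
    before-sector d x x∈S = ≮⇒≥ λ lt → <⇒≱ (δ-betweenʳ (before d) x d lt) (before-min d x x∈S)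

    -- Both colours are the first member of `S` after their common predecessor.
    before-injective : ∀ {c d} → S c ≡ true → S d ≡ true → before c ≡ before d → c ≡ d
    before-injective {c} {d} c∈S d∈S eq = δ-injectiveʳ (before c) (≤-antisym (before-sector c d d∈S)
      (subst (λ b → δ b d ≤ δ b c) (sym eq) (before-sector d c c∈S)))

    -- A colour has the maximal distance k to itself, so it can be its own nearest predecessor only
    -- if it is the sole member of `S`.
    before-≢ : ∀ c → ¬ (before c ≡ c)
    before-≢ c eq = let a , b , a∈S , b∈S , a≢b = two in a≢b (trans (only a a∈S) (sym (only b b∈S)))
      where
      only : ∀ x → S x ≡ true → x ≡ c
      only x x∈S = δ-injectiveˡ c (≤-antisym (δ-selfˡ c x) (subst (λ b → δ b c ≤ δ x c) eq (before-min c x x∈S)))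

    private
      nearest : ∀ c → ∃ λ p → S p ≡ true × (∀ x → S x ≡ true → δ c p ≤ δ c x)
      nearest c = argmin (λ x → S x ≟ᵇ true) (δ c) (before c , before-∈ c)

    after : Fin k → Fin k
    after c = proj₁ (nearest c)

    after-∈ : ∀ c → S (after c) ≡ true
    after-∈ c = proj₁ (proj₂ (nearest c))

    after-min : ∀ c x → S x ≡ true → δ c (after c) ≤ δ c x
    after-min c = proj₂ (proj₂ (nearest c))

    before-after : ∀ c → S c ≡ true → before (after c) ≡ c
    before-after c c∈S = sector c∈S (after-min c)

    parent-∈ : ∀ d → S d ≡ true → parent d ≡ before d
    parent-∈ d d∈S = trans (cong owner (F-∈ d d∈S)) (owner-vertex _ _)

    parent-≢ : ∀ d → ¬ (parent d ≡ d)
    parent-≢ d eq with bool-cases (S d)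
    ... | inj₁ d∈S = before-≢ d (trans (sym (parent-∈ d d∈S)) eq)
    ... | inj₂ d∉S = Rooted-irreflexive (rooted d) (trans (cong (λ b → if b then nothing else just (parent d)) (trans (cong S eq) d∉S)) (cong just eq))

    parent-closed : ∀ {d} → S d ≡ true → S (parent d) ≡ true
    parent-closed {d} d∈S = trans (cong S (parent-∈ d d∈S)) (before-∈ d)

    child-∉ : ∀ {d c} → parent d ≡ c → S c ≡ false → S d ≡ false
    child-∉ {d} refl c∉S with bool-cases (S d)
    ... | inj₁ d∈S = contradiction c∉S (true≢false (parent-closed d∈S))
    ... | inj₂ d∉S = d∉S

    -- `S` is closed under `parent`, so the finitely many arrival times have a common bound.
    eventually-∈ : ∃ λ T → ∀ d → S (iterate parent T d) ≡ true
    eventually-∈ = uniform-bound (λ t d → parent-closed) (λ d → go (rooted d))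
      where
      go : ∀ {d} → Rooted (block S) F d → ∃ λ t → S (iterate parent t d) ≡ true
      go (root eq) = 1 , block-nothing S _ eq
      go {d} (step eq re) with refl , _ ← block-just S _ eq | t , t∈S ← go re =
        suc t , trans (cong S (iterate-suc parent t d)) t∈S

    -- With a member of `S` below `c` the predecessor is found without wrapping around. This makes
    -- steps along the cycle well-founded once the cycle is cut open.
    before-< : ∀ {c x} → S x ≡ true → toℕ x < toℕ c → toℕ (before c) < toℕ c
    before-< {c} {x} x∈S x<c = ≰⇒> λ c≤b → <⇒≱ (far c≤b) (before-min c x x∈S)
      where
      open ≤-Reasoning
      far : toℕ c ≤ toℕ (before c) → δ x c < δ (before c) c
      far c≤b = ≤-<-trans (begin δ x c ≤⟨ m≤m+n _ (toℕ x) ⟩ δ x c + toℕ x ≡⟨ δ-< x c x<c ⟩ toℕ c ∎)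
        (+-cancelʳ-< (toℕ (before c)) _ _ (begin-strict
          toℕ c + toℕ (before c) <⟨ +-monoʳ-< (toℕ c) (Fin.toℕ<n (before c)) ⟩
          toℕ c + k ≡⟨ δ-≥ (before c) c c≤b ⟨ δ (before c) c + toℕ (before c) ∎))

    after-> : ∀ {c x} → S x ≡ true → toℕ c < toℕ x → toℕ c < toℕ (after c)
    after-> {c} {x} x∈S c<x = ≰⇒> λ a≤c → <⇒≱ (far a≤c) (after-min c x x∈S)
      where
      open ≤-Reasoning
      far : toℕ (after c) ≤ toℕ c → δ c x < δ c (after c)
      far a≤c = +-cancelʳ-< (toℕ c) _ _ (begin-strict
        δ c x + toℕ c ≡⟨ δ-< c x c<x ⟩ toℕ x <⟨ Fin.toℕ<n x ⟩ k ≤⟨ m≤n+m k _ ⟩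
        toℕ (after c) + k ≡⟨ δ-≥ c (after c) a≤c ⟨ δ c (after c) + toℕ c ∎)

-- Faces of a gluing

module _ {k : ℕ} {ℓ : Fin k → ℕ} {m : ℕ} (f : Gluing k ℓ m) where

  present? : ∀ v d → Dec (Present f v d)
  present? v d = Fin.any? λ j → f d j Fin.≟ v

  -- If the face entering each polygon strictly between a and b leaves it again at the same vertex,
  -- then the face arriving at the vertex along a leaves it along b.
  traverse : ∀ {v} a b (i : Fin (ℓ a)) (j : Fin (ℓ b)) → f a i ≡ v → f b j ≡ v →
    (∀ d i → f d i ≡ v → δ a d < δ a b → Orbit f (d , sucMod i) (d , i)) →
    Orbit f (a , i) (b , sucMod j)
  traverse {v} a b i j ai bj between = <-rec Claim go (δ a b) b j bj refl between
    where
    Between : Fin k → Set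
    Between b = ∀ d i → f d i ≡ v → δ a d < δ a b → Orbit f (d , sucMod i) (d , i)

    Claim : ℕ → Set
    Claim t = ∀ b (j : Fin (ℓ b)) → f b j ≡ v → δ a b ≡ t → Between b → Orbit f (a , i) (b , sucMod j)

    move : ∀ p b (jp : Fin (ℓ p)) (j : Fin (ℓ b)) → f p jp ≡ v → f b j ≡ v →
      (∀ x → Present f v x → δ p b ≤ δ x b) → Next f (p , jp) (b , sucMod j)
    move p b jp j pv bj min = j , trans bj (sym pv) , refl , λ d d∈v btw →
      <⇒≱ (δ-betweenʳ p d b (CycBetween⇒δ f p d b btw)) (min d (subst (λ u → Present f u d) pv d∈v))

    go : ∀ t → (∀ {s} → s < t → Claim s) → Claim t
    -- `p` is the last polygon at `v` before `b`. Unless it is `a`, the recursion reaches `p`, the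
    -- hypothesis leads around `p` back to `v`, and the face then leaves along `b`.
    go t rec b j bj eq between with argmin (present? v) (λ x → δ x b) (a , i , ai)
    ... | p , (jp , pv) , min with p Fin.≟ a
    ...   | yes refl = move p b i j ai bj min ◅ ε
    ...   | no p≢a = rec (subst (δ a p <_) eq lt) p jp pv refl (λ d i di lt′ → between d i di (<-trans lt′ lt))
                     ◅◅ between p jp pv lt ◅◅ (move p b jp j pv bj min ◅ ε)
      where
      lt : δ a p < δ a b
      lt = δ-betweenˡ a p b (≤∧≢⇒< (min a (i , ai)) (p≢a ∘ δ-injectiveˡ b))

-- Every code glues to a constellation

module Soundness {k : ℕ} (ℓ : Fin k → ℕ) (ℓ≥2 : ∀ c → 2 ≤ ℓ c) {m : ℕ} (total : sumFin (pred ∘ ℓ) ≡ m)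
  (S : Fin k → Bool) (F : Fin k → Fin m) (good : Normal.Good ℓ ℓ≥2 total S F) where
  open Normal ℓ ℓ≥2 total
  open Good good

  private
    f = glue F

  base-≢-nonbase : ∀ c p → ¬ (F c ≡ vertex c p)
  base-≢-nonbase c p eq = parent-≢ c (trans (cong owner eq) (owner-vertex c p))

  embedded : PolygonsEmbedded f
  embedded c {i} {j} eq with corner-view (ℓ≥2 c) i | corner-view (ℓ≥2 c) j
  ... | inj₁ refl | inj₁ refl = refl
  ... | inj₁ refl | inj₂ (p , refl) = contradiction eq (base-≢-nonbase c p)
  ... | inj₂ (p , refl) | inj₁ refl = contradiction (sym eq) (base-≢-nonbase c p)
  ... | inj₂ (p , refl) | inj₂ (p′ , refl) = cong nonbase (vertex-injective eq)

  present-view : ∀ {c p d} (i : Fin (ℓ d)) → f d i ≡ vertex c p →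
    (_≡_ {A = Corner k ℓ} (d , i) (c , nonbase p)) ⊎ (F d ≡ vertex c p × i ≡ start d)
  present-view {d = d} i eq with corner-view (ℓ≥2 d) i
  ... | inj₁ refl = inj₂ (eq , refl)
  ... | inj₂ (p′ , refl) with refl ← vertex-≡ eq = inj₁ refl

  F-parent : ∀ e → F e ≡ vertex (parent e) (place (F e))
  F-parent e = sym (vertex-owner (F e))

  parent-vertex : ∀ {e c p} → F e ≡ vertex c p → parent e ≡ c
  parent-vertex eq = trans (cong owner eq) (owner-vertex _ _)

  private
    -- The cycle is cut between `c₁` and `c₀`: the small face is followed upwards from `c₀`, the
    -- large face downwards from `c₁`.
    least : ∃ λ c → S c ≡ true × (∀ x → S x ≡ true → toℕ c ≤ toℕ x)
    least = argmin (λ x → S x ≟ᵇ true) toℕ (before _ , before-∈ (proj₁ two))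

    greatest : ∃ λ c → S c ≡ true × (∀ x → S x ≡ true → k ∸ toℕ c ≤ k ∸ toℕ x)
    greatest = argmin (λ x → S x ≟ᵇ true) (λ x → k ∸ toℕ x) (before _ , before-∈ (proj₁ two))

    c₀ c₁ : Fin k
    c₀ = proj₁ least
    c₁ = proj₁ greatest

  core-induction-up : (P : Fin k → Set) → P c₀ → (∀ c → S c ≡ true → P (before c) → P c) → ∀ c → S c ≡ true → P c
  core-induction-up P P₀ up c c∈S = <-rec Claim go (toℕ c) c refl c∈S
    where
    Claim : ℕ → Set
    Claim t = ∀ c → toℕ c ≡ t → S c ≡ true → P c
    go : ∀ t → (∀ {s} → s < t → Claim s) → Claim t
    go t rec c refl c∈S with c Fin.≟ c₀
    ... | yes refl = P₀
    ... | no c≢c₀ = up c c∈S (rec (before-< (proj₁ (proj₂ least))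
            (≤∧≢⇒< (proj₂ (proj₂ least) c c∈S) (c≢c₀ ∘ sym ∘ Fin.toℕ-injective))) (before c) refl (before-∈ c))

  core-induction-down : (P : Fin k → Set) → P c₁ → (∀ c → S c ≡ true → P (after c) → P c) → ∀ c → S c ≡ true → P c
  core-induction-down P P₁ down c c∈S = <-rec Claim go (k ∸ toℕ c) c refl c∈S
    where
    Claim : ℕ → Set
    Claim t = ∀ c → k ∸ toℕ c ≡ t → S c ≡ true → P c
    go : ∀ t → (∀ {s} → s < t → Claim s) → Claim t
    go t rec c refl c∈S with c Fin.≟ c₁
    ... | yes refl = P₁
    ... | no c≢c₁ = down c c∈S (rec (∸-monoʳ-< (after-> (proj₁ (proj₂ greatest)) c<c₁) (<⇒≤ (Fin.toℕ<n (after c)))) (after c) refl (after-∈ c))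
      where
      c<c₁ : toℕ c < toℕ c₁
      c<c₁ = ≤∧≢⇒< (≮⇒≥ λ lt → <⇒≱ (∸-monoʳ-< lt (<⇒≤ (Fin.toℕ<n c))) (proj₂ (proj₂ greatest) c c∈S))
                   (c≢c₁ ∘ Fin.toℕ-injective)

  private
    _~_ : Fin m → Fin m → Set
    _~_ = Star (Adjacent f)

    ~-sym : ∀ {u v} → u ~ v → v ~ u
    ~-sym = reverse λ { (c , j , inj₁ p) → c , j , inj₂ p ; (c , j , inj₂ p) → c , j , inj₁ p }

    polygon-~ : ∀ c i j → f c i ~ f c j
    polygon-~ c i = sucMod-induction (ℓ≥2 c) (λ j → f c i ~ f c j) ε (λ j path → path ◅◅ ((c , j , inj₁ (refl , refl)) ◅ ε))

    vertex-~ : ∀ c p → vertex c p ~ F c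
    vertex-~ c p = subst₂ _~_ (glue-nonbase F c p) (glue-base F c) (polygon-~ c (nonbase p) (start c))

    parent-~ : ∀ d → F d ~ F (parent d)
    parent-~ d = subst (_~ F (parent d)) (vertex-owner (F d)) (vertex-~ (parent d) (place (F d)))

    core-~ : ∀ c → S c ≡ true → F c ~ F c₀
    core-~ = core-induction-up (λ c → F c ~ F c₀) ε
      (λ c c∈S path → subst (λ x → F c ~ F x) (parent-∈ c c∈S) (parent-~ c) ◅◅ path)

    all-~ : ∀ d → Rooted (block S) F d → F d ~ F c₀
    all-~ d (root eq) = parent-~ d ◅◅ core-~ (parent d) (block-nothing S _ eq)
    all-~ d (step eq re) with refl , _ ← block-just S _ eq = parent-~ d ◅◅ all-~ _ re

  connected : Connected f
  connected u v = to-F u ◅◅ ~-sym (to-F v)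
    where
    to-F : ∀ v → v ~ F c₀
    to-F v = subst (_~ F c₀) (vertex-owner v) (vertex-~ _ (place v) ◅◅ all-~ _ (rooted (owner v)))

  -- What hangs at a non-base corner of such a polygon is a tree of polygons: the face arriving
  -- there runs around it and continues along `d`.
  Full : Fin k → Set
  Full d = ∀ p → Orbit f (d , nonbase p) (d , sucMod (nonbase p))

  around : ∀ {d} → Full d → ∀ j → Orbit f (d , sucMod (start d)) (d , j)
  around {d} full = sucMod-induction-nonbase (ℓ≥2 d) (λ j → Orbit f (d , sucMod (start d)) (d , j))
    (subst (λ x → Orbit f (d , sucMod (start d)) (d , x)) (sucMod-base (ℓ≥2 d)) ε)
    (λ p path → path ◅◅ full p)

  -- Going from `c` round to `c` passes every other polygon at the vertex, because `δ c c` is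
  -- maximal, and each of these is attached by its base.
  full-vertex : ∀ c p → (∀ e → F e ≡ vertex c p → Full e) → Orbit f (c , nonbase p) (c , sucMod (nonbase p))
  full-vertex c p full = traverse f c c (nonbase p) (nonbase p) (glue-nonbase F c p) (glue-nonbase F c p) between
    where
    between : ∀ d i → f d i ≡ vertex c p → δ c d < δ c c → Orbit f (d , sucMod i) (d , i)
    between d i eq lt with present-view i eq
    ... | inj₁ refl = contradiction lt (n≮n _)
    ... | inj₂ (eq′ , refl) = around (full d eq′) i

  -- Induction on a bound for the length of parent chains ending in `d`. After `T` steps every chain
  -- is inside `S`, so `T` is such a bound for a colour outside.
  full : ∀ d → S d ≡ false → Full d
  full d d∉S = let T , T∈S = eventually-∈ in
    go T d d∉S λ e eq → true≢false (T∈S e) (trans (cong S eq) d∉S)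
    where
    go : ∀ t d → S d ≡ false → (∀ e → ¬ (iterate parent t e ≡ d)) → Full d
    go zero d d∉S none = contradiction refl (none d)
    go (suc t) d d∉S none p = full-vertex d p λ e eq →
      go t e (child-∉ (parent-vertex eq) d∉S) λ e′ eq′ → none e′ (trans (cong parent eq′) (parent-vertex eq))

  ∈-place : ∀ {e c p} → S e ≡ true → F e ≡ vertex c p → before e ≡ c × p ≡ next₁ c
  ∈-place {e} e∈S eq with refl ← vertex-≡ (trans (sym eq) (F-∈ e e∈S)) = refl , refl

  ∉-place : ∀ {e c p} → ¬ (p ≡ next₁ c) → F e ≡ vertex c p → S e ≡ false
  ∉-place {e} ne eq with bool-cases (S e)
  ... | inj₁ e∈S = contradiction (proj₂ (∈-place e∈S eq)) ne
  ... | inj₂ e∉S = e∉S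

  -- Polygons of the cycle have their bases only at corners `next₁`, so at the other non-base
  -- corners of `c` only trees hang.
  core-around : ∀ c → ∀ j → ¬ (j ≡ nonbase (next₁ c)) → Orbit f (c , sucMod (nonbase (next₁ c))) (c , j)
  core-around c = sucMod-induction-after-first (ℓ≥2 c) (λ j → Orbit f (c , sucMod (nonbase (next₁ c))) (c , j)) ε
    (λ p p≢0 path → path ◅◅ full-vertex c p (λ e eq → full e (∉-place p≢0 eq)))

  -- The large face follows the cycle against the order of colours. Between `c` and `before c` it
  -- meets only trees, as `before-injective` leaves no other polygon of `S` with its base at this
  -- vertex.
  core-step : ∀ c → S c ≡ true → Orbit f (c , start c) (before c , sucMod (nonbase (next₁ (before c))))
  core-step c c∈S = traverse f c (before c) (start c) (nonbase (next₁ (before c)))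
    (trans (glue-base F c) (F-∈ c c∈S)) (glue-nonbase F _ _) between
    where
    between : ∀ d i → f d i ≡ vertex (before c) (next₁ (before c)) → δ c d < δ c (before c) → Orbit f (d , sucMod i) (d , i)
    between d i eq lt with present-view i eq
    ... | inj₁ refl = contradiction lt (n≮n _)
    ... | inj₂ (eq′ , refl) with bool-cases (S d)
    ...   | inj₂ d∉S = around (full d d∉S) i
    ...   | inj₁ d∈S with refl ← before-injective d∈S c∈S (proj₁ (∈-place d∈S eq′)) =
      contradiction (δ-self d (before d)) (<⇒≱ lt)

  -- The small face has one corner in each polygon of `S`, the one right after the base; all
  -- remaining corners are on the large face.
  small big : Corner k ℓ
  small = c₀ , nonbase (next₁ c₀)
  big = c₁ , start c₁

  big-after : ∀ c → S c ≡ true → Orbit f big (after c , start (after c)) → ∀ j → ¬ (j ≡ nonbase (next₁ c)) → Orbit f big (c , j)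
  big-after c c∈S path j ne = path ◅◅
    subst (λ x → Orbit f (after c , start (after c)) (x , sucMod (nonbase (next₁ x)))) (before-after c c∈S) (core-step (after c) (after-∈ c))
    ◅◅ core-around c j ne

  big-start : ∀ c → S c ≡ true → Orbit f big (c , start c)
  big-start = core-induction-down (λ c → Orbit f big (c , start c)) ε
    (λ c c∈S path → big-after c c∈S path (start c) (base≢nonbase (ℓ≥2 c)))

  big-core : ∀ c → S c ≡ true → ∀ j → ¬ (j ≡ nonbase (next₁ c)) → Orbit f big (c , j)
  big-core c c∈S = big-after c c∈S (big-start (after c) (after-∈ c))

  enter : ∀ {e c p} → F e ≡ vertex c p → (∀ d → F d ≡ vertex c p → S d ≡ false) →
    Orbit f (c , nonbase p) (e , sucMod (start e))
  enter {e} {c} {p} eq none = traverse f c e (nonbase p) (start e) (glue-nonbase F c p) (trans (glue-base F e) eq) between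
    where
    between : ∀ d i → f d i ≡ vertex c p → δ c d < δ c e → Orbit f (d , sucMod i) (d , i)
    between d i eq lt with present-view i eq
    ... | inj₁ refl = contradiction (δ-self c e) (<⇒≱ lt)
    ... | inj₂ (eq′ , refl) = around (full d (none d eq′)) i

  -- `F-∉` keeps `e` out of the sector from `c` up to `after c`, so a face starting at `after c`
  -- meets `e` before it returns to `c`.
  enter-core : ∀ {e c} → S c ≡ true → S e ≡ false → F e ≡ vertex c (next₁ c) →
    Orbit f (after c , start (after c)) (e , sucMod (start e))
  enter-core {e} {c} c∈S e∉S eq =
    traverse f a e (start a) (start e) (trans (glue-base F a) Fa) (trans (glue-base F e) eq) between
    where
    a = after c
    Fa : F a ≡ vertex c (next₁ c)
    Fa = trans (F-∈ a (after-∈ c)) (cong (λ x → vertex x (next₁ x)) (before-after c c∈S))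
    before-e : ¬ (before e ≡ c)
    before-e eq′ = F-∉ e e∉S (trans eq (cong (λ x → vertex x (next₁ x)) (sym eq′)))
    not-between : ¬ (δ a c < δ a e)
    not-between lt = before-e (sector c∈S λ x x∈S → ≮⇒≥ λ lt′ → <-asym (δ-betweenʳ a c e lt)
      (δ-betweenʳ c a e (≤-<-trans (after-min c x x∈S) lt′)))
    between : ∀ d i → f d i ≡ vertex c (next₁ c) → δ a d < δ a e → Orbit f (d , sucMod i) (d , i)
    between d i eq lt with present-view i eq
    ... | inj₁ refl = contradiction lt not-between
    ... | inj₂ (eq′ , refl) with bool-cases (S d)
    ...   | inj₂ d∉S = around (full d d∉S) i
    ...   | inj₁ d∈S = contradiction (δ-self a e) (<⇒≱ (subst (λ x → δ a x < δ a e)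
              (before-injective d∈S (after-∈ c) (trans (proj₁ (∈-place d∈S eq′)) (sym (before-after c c∈S)))) lt))

  big-rooted : ∀ e → S e ≡ false → Rooted (block S) F e → ∀ j → Orbit f big (e , j)
  big-rooted e e∉S re j = arrive re ◅◅ around (full e e∉S) j
    where
    arrive : Rooted (block S) F e → Orbit f big (e , sucMod (start e))
    arrive (step eq re) with refl , p∉S ← block-just S _ eq =
      big-rooted (parent e) p∉S re (nonbase (place (F e))) ◅◅
      enter (F-parent e) (λ d eq′ → child-∉ (parent-vertex eq′) p∉S)
    arrive (root eq) with place (F e) Fin.≟ next₁ (parent e)
    ... | no ne = big-core (parent e) (block-nothing S _ eq) (nonbase (place (F e))) (ne ∘ nonbase-injective {ℓ (parent e)})
      ◅◅ enter (F-parent e) (λ d → ∉-place ne)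
    ... | yes eq′ = big-start (after (parent e)) (after-∈ _) ◅◅
      enter-core (block-nothing S _ eq) e∉S (trans (F-parent e) (cong (vertex (parent e)) eq′))

  Small : Corner k ℓ → Set
  Small z = ∃ λ c → S c ≡ true × z ≡ (c , nonbase (next₁ c))

  -- A polygon between `c` and `after c` at this vertex would have its base there and `c` as its
  -- predecessor in `S`, which `F-∉` forbids.
  small-next : ∀ c → S c ≡ true → Next f (c , nonbase (next₁ c)) (after c , nonbase (next₁ (after c)))
  small-next c c∈S = start a , trans (glue-base F a) (trans Fa (sym (glue-nonbase F c (next₁ c)))) , sym (sucMod-base (ℓ≥2 a)) , none
    where
    a = after c
    Fa : F a ≡ vertex c (next₁ c)
    Fa = trans (F-∈ a (after-∈ c)) (cong (λ x → vertex x (next₁ x)) (before-after c c∈S))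
    none : ∀ d → Present f (f c (nonbase (next₁ c))) d → ¬ CycBetween f c d a
    none d (i , eq) btw with present-view i (trans eq (glue-nonbase F c (next₁ c))) | CycBetween⇒δ f c d a btw
    ... | inj₁ refl | lt = contradiction (δ-self c a) (<⇒≱ lt)
    ... | inj₂ (eq′ , refl) | lt with bool-cases (S d)
    ...   | inj₁ d∈S = contradiction (after-min c d d∈S) (<⇒≱ lt)
    ...   | inj₂ d∉S = F-∉ d d∉S (trans eq′ (cong (λ x → vertex x (next₁ x))
              (sym (sector c∈S λ x x∈S → ≤-trans (<⇒≤ lt) (after-min c x x∈S)))))

  -- `Next` is a relation, so other successors must be ruled out: they would pass over `after c` or
  -- contradict `F-∉`.
  small-closed : ∀ {c z} → S c ≡ true → Next f (c , nonbase (next₁ c)) z →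
    ∃ λ c′ → S c′ ≡ true × z ≡ (c′ , nonbase (next₁ c′)) × before c′ ≡ c
  small-closed {c} {c′ , _} c∈S (j′ , eq , refl , none) with present-view j′ (trans eq (glue-nonbase F c (next₁ c)))
  ... | inj₁ refl = contradiction (δ⇒CycBetween f c (after c) c (≤∧≢⇒< (δ-self c (after c)) (after-≢ ∘ δ-injectiveʳ c)))
          (none (after c) (start (after c) , trans (proj₁ (proj₂ (small-next c c∈S))) refl))
    where
    after-≢ : ¬ (after c ≡ c)
    after-≢ eq = before-≢ c (trans (cong before (sym eq)) (before-after c c∈S))
  ... | inj₂ (eq′ , refl) with bool-cases (S c′)
  ...   | inj₁ c′∈S = c′ , c′∈S , cong (c′ ,_) (sucMod-base (ℓ≥2 c′)) , proj₁ (∈-place c′∈S eq′)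
  ...   | inj₂ c′∉S = contradiction (trans eq′ (cong (λ x → vertex x (next₁ x)) (sym (sector c∈S min)))) (F-∉ c′ c′∉S)
    where
    min : ∀ x → S x ≡ true → δ c c′ ≤ δ c x
    min x x∈S = ≤-trans (≮⇒≥ λ lt → none (after c) (start (after c) , proj₁ (proj₂ (small-next c c∈S))) (δ⇒CycBetween f c (after c) c′ lt))
                        (after-min c x x∈S)

  small-orbit : ∀ {z z′} → Small z → Orbit f z z′ → Small z′
  small-orbit sz ε = sz
  small-orbit (c , c∈S , refl) (nx ◅ path) with c′ , c′∈S , refl , _ ← small-closed c∈S nx =
    small-orbit (c′ , c′∈S , refl) path

  private
    c₀∈S : S c₀ ≡ true
    c₀∈S = proj₁ (proj₂ least)

    orbit-small : ∀ {z} → Orbit f small z → Small z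
    orbit-small = small-orbit (c₀ , c₀∈S , refl)

  small-face : SmallFace f small
  small-face = distinct , increasing
    where
    distinct : ∀ z w → Orbit f small z → Orbit f small w → proj₁ z ≡ proj₁ w → z ≡ w
    distinct z w oz ow eq with orbit-small oz | orbit-small ow
    distinct z w oz ow refl | c , _ , refl | .c , _ , refl = refl
    increasing : ∀ z z′ w → Orbit f small z → Next f z z′ → Orbit f small w → ¬ CycBetween f (proj₁ z) (proj₁ w) (proj₁ z′)
    increasing z z′ w oz nx ow btw with orbit-small oz | orbit-small ow
    ... | c , c∈S , refl | d , d∈S , refl with small-closed c∈S nx
    ...   | c′ , c′∈S , refl , refl = <⇒≱ (CycBetween⇒δ f c d c′ btw) (before-sector c′ d d∈S)

  small-reaches : ∀ c → S c ≡ true → Orbit f small (c , nonbase (next₁ c))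
  small-reaches = core-induction-up (λ c → Orbit f small (c , nonbase (next₁ c))) ε λ c c∈S path → path ◅◅
    (subst (λ x → Next f (before c , nonbase (next₁ (before c))) (x , nonbase (next₁ x)))
      (before-injective (after-∈ _) c∈S (before-after _ (before-∈ c))) (small-next (before c) (before-∈ c)) ◅ ε)

  two-faces : ¬ Orbit f small big × (∀ z → Orbit f small z ⊎ Orbit f big z)
  two-faces = separate , covers
    where
    separate : ¬ Orbit f small big
    separate path with orbit-small path
    ... | c , _ , eq = go eq
      where
      go : ∀ {c} → ¬ (big ≡ (c , nonbase (next₁ c)))
      go {c} eq with cong proj₁ eq
      ... | refl = base≢nonbase (ℓ≥2 c₁) (pair eq)
        where
        pair : ∀ {c : Fin k} {i j : Fin (ℓ c)} → _≡_ {A = Corner k ℓ} (c , i) (c , j) → i ≡ j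
        pair refl = refl
    covers : ∀ z → Orbit f small z ⊎ Orbit f big z
    covers (c , j) with bool-cases (S c)
    ... | inj₂ c∉S = inj₂ (big-rooted c c∉S (rooted c) j)
    ... | inj₁ c∈S with j Fin.≟ nonbase (next₁ c)
    ...   | yes refl = inj₁ (small-reaches c c∈S)
    ...   | no ne = inj₂ (big-core c c∈S j ne)

-- Isomorphic gluings have the same code

iterate-cong : {A : Set} {g h : A → A} → (∀ x → g x ≡ h x) → ∀ t x → iterate g t x ≡ iterate h t x
iterate-cong eq zero x = refl
iterate-cong {h = h} eq (suc t) x = trans (eq _) (cong h (iterate-cong eq t x))

iterate-retract : {A : Set} {P : A → Set} {g h : A → A} → (∀ x → P x → P (g x)) → (∀ x → P x → h (g x) ≡ x) →
  ∀ t x → P x → iterate h t (iterate g t x) ≡ x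
iterate-retract {P = P} {g} {h} closed inverse t x Px = proj₂ (go t)
  where
  go : ∀ t → P (iterate g t x) × iterate h t (iterate g t x) ≡ x
  go zero = Px , refl
  go (suc t) = let Pt , eq = go t in closed _ Pt ,
    trans (iterate-suc h t _) (trans (cong (iterate h t) (inverse _ Pt)) eq)

module Uniqueness {k : ℕ} (ℓ : Fin k → ℕ) (ℓ≥2 : ∀ c → 2 ≤ ℓ c) {m : ℕ} (total : sumFin (pred ∘ ℓ) ≡ m) where
  open Normal ℓ ℓ≥2 total

  -- A colour of `S` is the `T`-th parent of its `T`-th successor on the cycle, and `T`-th parents
  -- lie in `S′` since both codes have the same parents.
  core-⊆ : ∀ {S S′ F F′} → Good S F → Good S′ F′ → F ≗ F′ → ∀ c → S c ≡ true → S′ c ≡ true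
  core-⊆ {S} {S′} good good′ eq c c∈S = let T , T∈S′ = G′.eventually-∈ in
    subst (λ x → S′ x ≡ true)
      (trans (sym (iterate-cong (λ d → cong owner (eq d)) T _))
             (iterate-retract {P = λ x → S x ≡ true} (λ x _ → G.after-∈ x)
               (λ x x∈S → trans (G.parent-∈ _ (G.after-∈ x)) (G.before-after x x∈S)) T c c∈S))
      (T∈S′ (iterate G.after T c))
    where
    module G = Good good
    module G′ = Good good′

  module _ {S S′ F F′} (good : Good S F) (good′ : Good S′ F′)
    (π : Permutation′ m) (r : Fin k → ℕ) (iso : ∀ c j → π ⟨$⟩ʳ glue F c j ≡ glue F′ c (addMod j (r c))) where
    private
      module G = Good good
      module G′ = Good good′
      module A = Soundness ℓ ℓ≥2 total S F good
      module A′ = Soundness ℓ ℓ≥2 total S′ F′ good′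

    π-injective : ∀ {u v} → π ⟨$⟩ʳ u ≡ π ⟨$⟩ʳ v → u ≡ v
    π-injective eq = trans (sym (inverseˡ π)) (trans (cong (π ⟨$⟩ˡ_) eq) (inverseˡ π))

    Moves : Fin k → Set
    Moves c = ¬ (addMod (start c) (r c) ≡ start c)

    fixed : ∀ {c} → addMod (start c) (r c) ≡ start c → ∀ j → addMod j (r c) ≡ j
    fixed {c} eq = sucMod-induction (ℓ≥2 c) (λ j → addMod j (r c) ≡ j) eq
      (λ j eq → trans (addMod-comm j 1 (r c)) (cong sucMod eq))

    preimage : ∀ c (j : Fin (ℓ c)) → ∃ λ i → addMod i (r c) ≡ j
    preimage c j = addMod j (r c * pred (ℓ c)) , trans (addMod-comm j _ (r c)) (addMod-inverse j (r c))

    iso-base : ∀ c → π ⟨$⟩ʳ F c ≡ glue F′ c (addMod (start c) (r c))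
    iso-base c = trans (cong (π ⟨$⟩ʳ_) (sym (glue-base F c))) (iso c (start c))

    iso-nonbase : ∀ c p → π ⟨$⟩ʳ vertex c p ≡ glue F′ c (addMod (nonbase p) (r c))
    iso-nonbase c p = trans (cong (π ⟨$⟩ʳ_) (sym (glue-nonbase F c p))) (iso c (nonbase p))

    -- The corner of `c` that is rotated into the base lands on a non-base corner of the target
    -- parent e. Pulled back, that vertex is a non-base corner of `c`, so e can touch it only with
    -- its base. Thus `c` is the source parent of e, and e is rotated as well.
    moves-parent′ : ∀ c → Moves c → ∃ λ (p : Fin (pred (ℓ c))) →
      addMod (nonbase p) (r c) ≡ start c × F (G′.parent c) ≡ vertex c p × Moves (G′.parent c)
    moves-parent′ c mv with preimage c (start c)
    ... | i , eq with corner-view (ℓ≥2 c) i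
    ...   | inj₁ refl = contradiction eq mv
    ...   | inj₂ (p , refl) with preimage (G′.parent c) (nonbase (place (F′ c)))
    ...     | j , eq′ with A.present-view j
                (π-injective (trans (iso (G′.parent c) j) (trans (cong (glue F′ (G′.parent c)) eq′)
                  (trans (glue-nonbase F′ _ (place (F′ c))) (trans (vertex-owner (F′ c)) (sym
                    (trans (iso-nonbase c p) (trans (cong (glue F′ c) eq) (glue-base F′ c)))))))))
    ...       | inj₁ same = contradiction (cong proj₁ same) (G′.parent-≢ c)
    ...       | inj₂ (Fp , refl) = p , eq , Fp , λ eq″ → base≢nonbase (ℓ≥2 (G′.parent c)) (trans (sym eq″) eq′)

    moves-parent : ∀ c → Moves c → ∃ λ (p : Fin (pred (ℓ c))) →
      addMod (start c) (r c) ≡ nonbase p × F′ (G.parent c) ≡ vertex c p × Moves (G.parent c)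
    moves-parent c mv with corner-view (ℓ≥2 c) (addMod (start c) (r c))
    ... | inj₁ eq = contradiction eq mv
    ... | inj₂ (p , eq) with A′.present-view (addMod (nonbase (place (F c))) (r (G.parent c)))
                (trans (sym (iso-nonbase (G.parent c) (place (F c)))) (trans (cong (π ⟨$⟩ʳ_) (vertex-owner (F c)))
                  (trans (iso-base c) (trans (cong (glue F′ c) eq) (glue-nonbase F′ c p)))))
    ...   | inj₁ same = contradiction (cong proj₁ same) (G.parent-≢ c)
    ...   | inj₂ (Fp , eq′) = p , eq , Fp , λ eq″ → base≢nonbase (ℓ≥2 (G.parent c))
              (addMod-injective (r (G.parent c)) (trans eq″ (sym eq′)))

    -- On rotated polygons the source parent undoes the target parent, so `c` is a `T`-th parent and
    -- hence in `S`.
    moves-∈ : ∀ c → Moves c → S c ≡ true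
    moves-∈ c mv = let T , T∈S = G.eventually-∈ in subst (λ x → S x ≡ true)
      (iterate-retract {P = Moves} (λ x mv → proj₂ (proj₂ (proj₂ (moves-parent′ x mv))))
        (λ x mv → A.parent-vertex (proj₁ (proj₂ (proj₂ (moves-parent′ x mv))))) T c mv)
      (T∈S (iterate G′.parent T c))

    moves-∈′ : ∀ c → Moves c → S′ c ≡ true
    moves-∈′ c mv = let T , T∈S = G′.eventually-∈ in subst (λ x → S′ x ≡ true)
      (iterate-retract {P = Moves} (λ x mv → proj₂ (proj₂ (proj₂ (moves-parent x mv))))
        (λ x mv → A′.parent-vertex (proj₁ (proj₂ (proj₂ (moves-parent x mv))))) T c mv)
      (T∈S (iterate G.parent T c))

    private
      -- For a third colour `x`, e would lie between c and `x` and also c between e and `x`, which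
      -- is impossible in a cyclic order.
      only-two : ∀ {c e : Fin k} x → δ c e ≤ δ c x → δ e c ≤ δ e x → x ≡ c ⊎ x ≡ e
      only-two {c} {e} x ce ec with x Fin.≟ c | x Fin.≟ e
      ... | yes eq | _ = inj₁ eq
      ... | no _ | yes eq = inj₂ eq
      ... | no x≢c | no x≢e = contradiction (δ-betweenʳ c e x (≤∧≢⇒< ce (x≢e ∘ sym ∘ δ-injectiveʳ c)))
        (<-asym (δ-betweenʳ e c x (≤∧≢⇒< ec (x≢c ∘ sym ∘ δ-injectiveʳ e))))

    -- If the isomorphism reverses the cycle, then the cycle increases in both directions, so it consists
    -- of two digons; nothing else can be attached to them.
    module _ (c : Fin k) (c-moves : Moves c) where
      private
        e : Fin k
        e = G′.parent c
        e-moves : Moves e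
        e-moves = proj₂ (proj₂ (proj₂ (moves-parent′ c c-moves)))
        c∈S = moves-∈ c c-moves
        e∈S = moves-∈ e e-moves
        c∈S′ = moves-∈′ c c-moves
        e∈S′ = moves-∈′ e e-moves

        before-e : G.before e ≡ c
        before-e = trans (sym (G.parent-∈ e e∈S)) (A.parent-vertex (proj₁ (proj₂ (proj₂ (moves-parent′ c c-moves)))))
        before′-c : G′.before c ≡ e
        before′-c = sym (G′.parent-∈ c c∈S′)

        near-c : ∀ x → S x ≡ true → δ c e ≤ δ c x
        near-c x x∈S = subst (λ b → δ b e ≤ δ b x) before-e (G.before-sector e x x∈S)
        near-e : ∀ x → S′ x ≡ true → δ e c ≤ δ e x
        near-e x x∈S′ = subst (λ b → δ b c ≤ δ b x) before′-c (G′.before-sector c x x∈S′)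

        moves-two : ∀ x → Moves x → x ≡ c ⊎ x ≡ e
        moves-two x mv = only-two x (near-c x (moves-∈ x mv)) (near-e x (moves-∈′ x mv))

        before-c : G.before c ≡ e
        before-c with moves-two (G.parent c) (proj₂ (proj₂ (proj₂ (moves-parent c c-moves))))
        ... | inj₁ eq = contradiction eq (G.parent-≢ c)
        ... | inj₂ eq = trans (sym (G.parent-∈ c c∈S)) eq

        before′-e : G′.before e ≡ c
        before′-e with moves-two (G′.parent e) (proj₂ (proj₂ (proj₂ (moves-parent′ e e-moves))))
        ... | inj₁ eq = trans (sym (G′.parent-∈ e e∈S′)) eq
        ... | inj₂ eq = contradiction eq (G′.parent-≢ e)

        S-two : ∀ x → S x ≡ true → x ≡ c ⊎ x ≡ e
        S-two x x∈S = only-two x (near-c x x∈S) (subst (λ b → δ b c ≤ δ b x) before-c (G.before-sector c x x∈S))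

        S′-two : ∀ x → S′ x ≡ true → x ≡ c ⊎ x ≡ e
        S′-two x x∈S = only-two x (subst (λ b → δ b e ≤ δ b x) before′-e (G′.before-sector e x x∈S)) (near-e x x∈S)

        S⊆S′ : ∀ x → S x ≡ true → S′ x ≡ true
        S⊆S′ x x∈S with S-two x x∈S
        ... | inj₁ refl = c∈S′
        ... | inj₂ refl = e∈S′

        S′⊆S : ∀ x → S′ x ≡ true → S x ≡ true
        S′⊆S x x∈S with S′-two x x∈S
        ... | inj₁ refl = c∈S
        ... | inj₂ refl = e∈S

        before-≡ : ∀ x → G.before x ≡ G′.before x
        before-≡ x = δ-injectiveˡ x (≤-antisym (G.before-min x _ (S′⊆S _ (G′.before-∈ x)))
                                               (G′.before-min x _ (S⊆S′ _ (G.before-∈ x))))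

        module _ {a b} (a-moves : Moves a) (b∈S : S b ≡ true) (before-a : G.before a ≡ b) (before-b : G.before b ≡ a)
                 (S-ab : ∀ x → S x ≡ true → x ≡ a ⊎ x ≡ b) where

          a∈S = moves-∈ a a-moves

          Fb : F b ≡ vertex a (next₁ a)
          Fb = trans (G.F-∈ b b∈S) (cong (λ x → vertex x (next₁ x)) before-b)
          F′b : F′ b ≡ vertex a (next₁ a)
          F′b = trans (G′.F-∈ b (S⊆S′ b b∈S)) (cong (λ x → vertex x (next₁ x)) (trans (sym (before-≡ b)) before-b))
          F′a : F′ a ≡ vertex b (next₁ b)
          F′a = trans (G′.F-∈ a (S⊆S′ a a∈S)) (cong (λ x → vertex x (next₁ x)) (trans (sym (before-≡ a)) before-a))

          parent-a : G.parent a ≡ b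
          parent-a = trans (G.parent-∈ a a∈S) before-a
          parent′-a : G′.parent a ≡ b
          parent′-a = trans (cong owner F′a) (owner-vertex _ _)

          turn-base : addMod (start a) (r a) ≡ nonbase (next₁ a)
          turn-base with moves-parent a a-moves
          ... | p , eq , Fp , _ = trans eq (cong nonbase (vertex-injective
            (trans (sym Fp) (trans (cong F′ parent-a) F′b))))

          turn-next : addMod (nonbase (next₁ a)) (r a) ≡ start a
          turn-next with moves-parent′ a a-moves
          ... | p , eq , Fp , _ = trans (cong (λ x → addMod (nonbase x) (r a)) (vertex-injective
            (trans (sym (trans (cong F parent′-a) Fb)) Fp))) eq

          -- The rotation exchanges the base with the corner after it, so two steps from the base
          -- lead back to it.
          digon : ∀ (p : Fin (pred (ℓ a))) → p ≡ next₁ a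
          digon p with sucMod-induction (ℓ≥2 a) (λ j → j ≡ start a ⊎ j ≡ nonbase (next₁ a)) {start a} (inj₁ refl)
            (λ { j (inj₁ refl) → inj₂ (sucMod-base (ℓ≥2 a))
               ; j (inj₂ refl) → inj₁ (trans (cong sucMod (sym turn-base)) (trans (addMod-comm (start a) (r a) 1)
                   (trans (cong (λ x → addMod x (r a)) (sucMod-base (ℓ≥2 a))) turn-next))) }) (nonbase p)
          ... | inj₁ eq = contradiction (sym eq) (base≢nonbase (ℓ≥2 a))
          ... | inj₂ eq = nonbase-injective {ℓ a} eq

          -- A polygon `x` on the digon `a` sits at its only non-base vertex, so `F-∉` forces its
          -- predecessor in `S` to be `b`. The isomorphism swaps the two vertices of the cycle and
          -- moves `x` to the vertex of `b` that `F-∉` forbids in the target.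
          nothing-attached : ∀ x → S x ≡ false → ¬ (G.parent x ≡ a)
          nothing-attached x x∉S refl = G′.F-∉ x x∉S′ (trans F′x (cong (λ y → vertex y (next₁ y)) (trans (sym before-x) (before-≡ x))))
            where
            Fx : F x ≡ vertex a (next₁ a)
            Fx = trans (A.F-parent x) (cong (vertex a) (digon (place (F x))))
            before-x : G.before x ≡ b
            before-x with S-ab (G.before x) (G.before-∈ x)
            ... | inj₁ eq = contradiction (trans Fx (cong (λ y → vertex y (next₁ y)) (sym eq))) (G.F-∉ x x∉S)
            ... | inj₂ eq = eq
            x∉S′ : S′ x ≡ false
            x∉S′ with bool-cases (S′ x)
            ... | inj₁ x∈S′ = contradiction x∉S (true≢false (S′⊆S x x∈S′))
            ... | inj₂ eq = eq
            still : addMod (start x) (r x) ≡ start x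
            still with addMod (start x) (r x) Fin.≟ start x
            ... | yes eq = eq
            ... | no mv = contradiction x∉S (true≢false (moves-∈ x mv))
            F′x : F′ x ≡ vertex b (next₁ b)
            F′x = begin
              F′ x ≡⟨ glue-base F′ x ⟨
              glue F′ x (start x) ≡⟨ cong (glue F′ x) still ⟨
              glue F′ x (addMod (start x) (r x)) ≡⟨ iso-base x ⟨
              π ⟨$⟩ʳ F x ≡⟨ cong (π ⟨$⟩ʳ_) Fx ⟩
              π ⟨$⟩ʳ vertex a (next₁ a) ≡⟨ iso-nonbase a (next₁ a) ⟩
              glue F′ a (addMod (nonbase (next₁ a)) (r a)) ≡⟨ cong (glue F′ a) turn-next ⟩
              glue F′ a (start a) ≡⟨ glue-base F′ a ⟩
              F′ a ≡⟨ F′a ⟩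
              vertex b (next₁ b) ∎
              where open ≡-Reasoning

        all-∈ : ∀ x → Rooted (block S) F x → ¬ (S x ≡ false)
        all-∈ x (step eq re) x∉S = all-∈ _ re (proj₂ (block-just S _ eq))
        all-∈ x (root eq) x∉S with S-two (G.parent x) (block-nothing S _ eq)
        ... | inj₁ eq′ = nothing-attached c-moves e∈S before-c before-e S-two x x∉S eq′
        ... | inj₂ eq′ = nothing-attached e-moves c∈S before-e before-c (λ x x∈S → Sum.swap (S-two x x∈S)) x x∉S eq′

      reversed-≡ : F ≗ F′
      reversed-≡ x with bool-cases (S x)
      ... | inj₁ x∈S = trans (G.F-∈ x x∈S) (trans (cong (λ y → vertex y (next₁ y)) (before-≡ x)) (sym (G′.F-∈ x (S⊆S′ x x∈S))))
      ... | inj₂ x∉S = contradiction x∉S (all-∈ x (G.rooted x))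

    iso-≡ : F ≗ F′
    iso-≡ with Fin.any? (λ c → ¬? (addMod (start c) (r c) Fin.≟ start c))
    ... | yes (c , mv) = reversed-≡ c mv
    ... | no none = λ c → begin
      F c ≡⟨ π-id (F c) ⟨
      π ⟨$⟩ʳ F c ≡⟨ iso-base c ⟩
      glue F′ c (addMod (start c) (r c)) ≡⟨ cong (glue F′ c) (still c) ⟩
      glue F′ c (start c) ≡⟨ glue-base F′ c ⟩
      F′ c ∎
      where
      open ≡-Reasoning
      still : ∀ c → addMod (start c) (r c) ≡ start c
      still c with addMod (start c) (r c) Fin.≟ start c
      ... | yes eq = eq
      ... | no mv = contradiction (c , mv) none
      π-id : ∀ v → π ⟨$⟩ʳ v ≡ v
      π-id v = begin
        π ⟨$⟩ʳ v ≡⟨ cong (π ⟨$⟩ʳ_) (vertex-owner v) ⟨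
        π ⟨$⟩ʳ vertex (owner v) (place v) ≡⟨ iso-nonbase (owner v) (place v) ⟩
        glue F′ (owner v) (addMod (nonbase (place v)) (r (owner v))) ≡⟨ cong (glue F′ (owner v)) (fixed (still (owner v)) (nonbase (place v))) ⟩
        glue F′ (owner v) (nonbase (place v)) ≡⟨ glue-nonbase F′ (owner v) (place v) ⟩
        vertex (owner v) (place v) ≡⟨ vertex-owner v ⟩
        v ∎

-- Every constellation has a code

least-ℕ : {P : ℕ → Set} → Decidable P → ∃ P → ∃ λ t → P t × (∀ s → P s → t ≤ s)
least-ℕ {P} P? (t , Pt) = go P? t Pt
  where
  go : {P : ℕ → Set} → Decidable P → ∀ t → P t → ∃ λ t → P t × (∀ s → P s → t ≤ s)
  go P? t Pt with P? 0
  ... | yes P0 = 0 , P0 , λ _ _ → z≤n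
  go P? zero Pt | no ¬P0 = contradiction Pt ¬P0
  go P? (suc t) Pt | no ¬P0 with go (P? ∘ suc) t Pt
  ... | u , Pu , min = suc u , Pu , λ { zero P0 → contradiction P0 ¬P0 ; (suc s) Ps → s≤s (min s Ps) }

injective⇒surjective : ∀ {n} {g : Fin n → Fin n} → Injective _≡_ _≡_ g → ∀ u → ∃ λ v → g v ≡ u
injective⇒surjective {suc n} {g} inj u with Fin.any? (λ v → g v Fin.≟ u)
... | yes hit = hit
... | no miss = contradiction
  (Fin.injective⇒≤ {f = λ v → punchOut (λ eq → miss (v , sym eq))} (inj ∘ Fin.punchOut-injective {i = u} _ _)) (n≮n n)

iterate-+ : {A : Set} (h : A → A) → ∀ a b x → iterate h (a + b) x ≡ iterate h a (iterate h b x)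
iterate-+ h zero b x = refl
iterate-+ h (suc a) b x = cong h (iterate-+ h a b x)

iterate-injective : {A : Set} {h : A → A} → Injective _≡_ _≡_ h → ∀ t → Injective _≡_ _≡_ (iterate h t)
iterate-injective inj zero eq = eq
iterate-injective inj (suc t) eq = iterate-injective inj t (inj eq)

module Completeness {k : ℕ} (ℓ : Fin k → ℕ) (ℓ≥2 : ∀ c → 2 ≤ ℓ c) {m : ℕ} (total : sumFin (pred ∘ ℓ) ≡ m)
  (f : Gluing k ℓ m) (embedded : PolygonsEmbedded f) (connected : Connected f)
  (x : Corner k ℓ) (small : SmallFace f x) where
  open Normal ℓ ℓ≥2 total

  at : Corner k ℓ → Fin m
  at (c , j) = f c j

  private
    abstract
      next-exists : ∀ z → ∃ λ z′ → Next f z z′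
      next-exists (c , j) with argmin (present? f (f c j)) (δ c) (c , j , refl)
      ... | c′ , (j′ , eq) , min = (c′ , sucMod j′) , j′ , eq , refl ,
        λ d d∈v btw → <⇒≱ (CycBetween⇒δ f c d c′ btw) (min d d∈v)

  next : Corner k ℓ → Corner k ℓ
  next z = proj₁ (next-exists z)

  next-Next : ∀ z → Next f z (next z)
  next-Next z = proj₂ (next-exists z)

  -- Of two colours arriving at the same vertex and leaving along the same side, the nearer one
  -- would lie between the farther one and that side.
  Next-injective : ∀ {a b z} → Next f a z → Next f b z → a ≡ b
  Next-injective {c , j} {c₂ , j₂} {c′ , _} (j′ , eq , refl , none) (j₂′ , eq₂ , s , none₂)
    with refl ← addMod-injective {i = j′} {j₂′} 1 s
    with c Fin.≟ c₂
  ... | yes refl = cong (c ,_) (embedded c (trans (sym eq) eq₂))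
  ... | no c≢c₂ with <-≤-connex (δ c c′) (δ c₂ c′)
  ...   | inj₁ lt = contradiction (δ⇒CycBetween f c₂ c c′ (δ-betweenˡ c₂ c c′ lt)) (none₂ c (j , trans (sym eq) eq₂))
  ...   | inj₂ ge = contradiction (δ⇒CycBetween f c c₂ c′ (δ-betweenˡ c c₂ c′ (≤∧≢⇒< ge (c≢c₂ ∘ sym ∘ δ-injectiveˡ c′))))
                                  (none c₂ (j₂ , trans (sym eq₂) eq))

  next-injective : Injective _≡_ _≡_ next
  next-injective {a} {b} eq = Next-injective (next-Next a) (subst (Next f b) (sym eq) (next-Next b))

  it : ℕ → Corner k ℓ
  it t = iterate next t x

  colour : ℕ → Fin k
  colour t = proj₁ (it t)

  it-orbit : ∀ t → Orbit f x (it t)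
  it-orbit zero = ε
  it-orbit (suc t) = it-orbit t ◅◅ (next-Next (it t) ◅ ε)

  it-≡ : ∀ s t → colour s ≡ colour t → it s ≡ it t
  it-≡ s t = proj₁ small _ _ (it-orbit s) (it-orbit t)

  private
    abstract
      -- Among k + 1 corners of the face two share a colour. On a small face they coincide, and
      -- injectivity of `next` cancels the common initial stretch.
      period : ∃ λ P → it (suc P) ≡ x
      period with Fin.pigeonhole (n<1+n k) (colour ∘ toℕ)
      ... | i , j , i<j , eq with m<n⇒0<n∸m i<j | iterate-injective next-injective (toℕ i)
              (trans (sym (iterate-+ next (toℕ i) (toℕ j ∸ toℕ i) x)) (trans (cong it (m+[n∸m]≡n (<⇒≤ i<j))) (sym (it-≡ (toℕ i) (toℕ j) eq))))
      ...   | pos | eq′ with toℕ j ∸ toℕ i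
      ...     | suc P = P , eq′

    P : ℕ
    P = proj₁ period

    reduce : ∀ t → ∃ λ s → s < suc P × it t ≡ it s
    reduce zero = 0 , s≤s z≤n , refl
    reduce (suc t) with reduce t
    ... | s , s≤P , eq with m≤n⇒m<n∨m≡n s≤P
    ...   | inj₁ s<P = suc s , s<P , cong next eq
    ...   | inj₂ refl = 0 , s≤s z≤n , trans (cong next eq) (proj₂ period)

    abstract
      S? : ∀ c → Dec (∃ λ (s : Fin (suc P)) → colour (toℕ s) ≡ c)
      S? c = Fin.any? λ s → colour (toℕ s) Fin.≟ c

  S : Fin k → Bool
  S c = does (S? c)

  colour-∈ : ∀ t → S (colour t) ≡ true
  colour-∈ t with reduce t
  ... | s , s<P , eq = dec-true (S? (colour t)) (fromℕ< s<P , trans (cong colour (Fin.toℕ-fromℕ< s<P)) (cong proj₁ (sym eq)))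

  ∈-colour : ∀ c → S c ≡ true → ∃ λ t → colour (suc t) ≡ c
  ∈-colour c c∈S with S? c
  -- Time 0 is replaced by a full period, so that the corner has a predecessor on the face.
  ... | yes (zero , eq) = P , trans (cong proj₁ (proj₂ period)) eq
  ... | yes (suc s , eq) = toℕ s , eq
  ... | no _ with () ← c∈S

  -- Distance is counted in polygons: one step joins any two corners of the same polygon.
  Reach : ℕ → Fin m → Set
  Reach zero v = v ≡ at x
  Reach (suc t) v = ∃₂ λ c j → f c j ≡ v × ∃ λ j′ → Reach t (f c j′)

  reach? : ∀ t v → Dec (Reach t v)
  reach? zero v = v Fin.≟ at x
  reach? (suc t) v = Fin.any? λ c → Fin.any? λ j → (f c j Fin.≟ v) ×-dec Fin.any? λ j′ → reach? t (f c j′)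

  private
    reached : ∀ {u v} → ∃ (λ t → Reach t u) → Star (Adjacent f) u v → ∃ λ t → Reach t v
    reached r ε = r
    reached (t , r) ((c , j , inj₁ (refl , eq)) ◅ path) = reached (suc t , c , sucMod j , eq , j , r) path
    reached (t , r) ((c , j , inj₂ (eq , refl)) ◅ path) = reached (suc t , c , j , eq , sucMod j , r) path

    abstract
      nearest : ∀ v → ∃ λ t → Reach t v × (∀ s → Reach s v → t ≤ s)
      nearest v = least-ℕ (λ t → reach? t v) (reached (0 , refl) (connected (at x) v))

  dist : Fin m → ℕ
  dist v = proj₁ (nearest v)

  dist-min : ∀ {v s} → Reach s v → dist v ≤ s
  dist-min {v} = proj₂ (proj₂ (nearest v)) _

  -- On the cycle, the side leaving the base is the one along which the small face goes from `it t`
  -- to `it (suc t)`. Off the cycle, "far" refers to the polygon: its base is a corner nearest to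
  -- the vertex of `x`.
  CoreBase FarBase : ∀ c → Fin (ℓ c) → Set
  CoreBase c ρ = ∃ λ t → it (suc t) ≡ (c , sucMod ρ) × f c ρ ≡ at (it t)
  FarBase c ρ = ∀ j → dist (f c ρ) ≤ dist (f c j)

  private
    choose-base : ∀ c → ∃ λ ρ → (S c ≡ true → CoreBase c ρ) × (S c ≡ false → FarBase c ρ)
    choose-base c with bool-cases (S c)
    ... | inj₁ c∈S with ∈-colour c c∈S
    ...   | t , refl = let ρ , eq , eq′ , _ = next-Next (it t) in
      ρ , (λ _ → t , cong (colour (suc t) ,_) eq′ , eq) , λ c∉S → contradiction c∉S (true≢false c∈S)
    choose-base c | inj₂ c∉S with argmin {P = λ _ → ⊤} (λ _ → yes tt) (λ j → dist (f c j)) (start c , tt)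
    ... | ρ , _ , min = ρ , (λ c∈S → contradiction c∉S (true≢false c∈S)) , λ _ j → min j tt

    abstract
      base-exists : ∀ c → ∃ λ ρ → (S c ≡ true → CoreBase c ρ) × (S c ≡ false → FarBase c ρ)
      base-exists = choose-base

  ρ : ∀ c → Fin (ℓ c)
  ρ c = proj₁ (base-exists c)

  ρ-∈ : ∀ {c} → S c ≡ true → CoreBase c (ρ c)
  ρ-∈ {c} = proj₁ (proj₂ (base-exists c))

  ρ-∉ : ∀ {c} → S c ≡ false → FarBase c (ρ c)
  ρ-∉ {c} = proj₂ (proj₂ (base-exists c))

  it-ρ : ∀ t → it t ≡ (colour t , sucMod (ρ (colour t)))
  it-ρ t = let s , eq , _ = ρ-∈ (colour-∈ t) in trans (it-≡ t (suc s) (cong proj₁ (sym eq))) eq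

  -- The second alternative says that the polygon is based strictly nearer to the vertex of `x`;
  -- this decrease is what makes the code rooted.
  Rep : Fin m → Set
  Rep v = ∃₂ λ e j → ¬ (j ≡ ρ e) × f e j ≡ v ×
    (S e ≡ true ⊎ (S e ≡ false × dist (f e (ρ e)) < dist v))

  private
    on-core : ∀ e j → S e ≡ true → Rep (f e j)
    on-core e j e∈S with j Fin.≟ ρ e
    ... | no ne = e , j , ne , refl , inj₁ e∈S
    ... | yes refl with ρ-∈ e∈S
    ...   | t , _ , eq = colour t , sucMod (ρ (colour t)) , sucMod-≢ (ℓ≥2 _) (ρ (colour t)) ,
      trans (cong at (sym (it-ρ t))) (sym eq) , inj₁ (colour-∈ t)

    -- The last polygon of a shortest path to `v` serves if it is off the cycle, for its base is
    -- nearer than `v`. If it is on the cycle and `v` is its base, the preceding polygon of the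
    -- cycle serves.
    rep-from : ∀ v t → dist v ≡ t → Reach t v → Rep v
    rep-from v zero eq refl = on-core (proj₁ x) (proj₂ x) (colour-∈ 0)
    rep-from v (suc t) eq (c , j , refl , j′ , r) with bool-cases (S c)
    ... | inj₁ c∈S = on-core c j c∈S
    ... | inj₂ c∉S = c , j , (λ { refl → <⇒≱ closer ≤-refl }) , refl , inj₂ (c∉S , closer)
      where
      closer : dist (f c (ρ c)) < dist (f c j)
      closer = subst (dist (f c (ρ c)) <_) (sym eq) (s≤s (≤-trans (ρ-∉ c∉S j′) (dist-min r)))

    abstract
      rep : ∀ v → Rep v
      rep v = rep-from v (dist v) refl (proj₁ (proj₂ (nearest v)))

  turn : Fin k → ℕ
  turn c = proj₁ (rotate-to-base (ℓ≥2 c) (ρ c))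

  turn-ρ : ∀ c → addMod (ρ c) (turn c) ≡ start c
  turn-ρ c = proj₂ (rotate-to-base (ℓ≥2 c) (ρ c))

  turn-view : ∀ c j → j ≡ ρ c ⊎ ∃ λ (p : Fin (pred (ℓ c))) → addMod j (turn c) ≡ nonbase p × j ≡ addMod (ρ c) (suc (toℕ p))
  turn-view c j with corner-view (ℓ≥2 c) (addMod j (turn c))
  ... | inj₁ eq = inj₁ (addMod-injective (turn c) (trans eq (sym (turn-ρ c))))
  ... | inj₂ (p , eq) = inj₂ (p , eq , addMod-injective (turn c) (trans eq (trans (sym (addMod-base-suc (ℓ≥2 c) p))
    (trans (cong (λ i → addMod i (suc (toℕ p))) (sym (turn-ρ c))) (addMod-comm (ρ c) (turn c) (suc (toℕ p)))))))

  -- Reads a vertex of the normal form as the name of a non-base corner, counted from `ρ`, and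
  -- returns the vertex of `f` at that corner. Its surjectivity comes from `rep`.
  φ : Fin m → Fin m
  φ v = f (owner v) (addMod (ρ (owner v)) (suc (toℕ (place v))))

  φ-vertex : ∀ c p → φ (vertex c p) ≡ f c (addMod (ρ c) (suc (toℕ p)))
  φ-vertex c p = cong (λ (c , p) → f c (addMod (ρ c) (suc (toℕ p)))) (decodeTo-encodeTo (pred ∘ ℓ) total (c , p))

  private
    find-vertex : ∀ v → ∃ λ u → φ u ≡ v × (S (owner u) ≡ true ⊎ (S (owner u) ≡ false × dist (f (owner u) (ρ (owner u))) < dist v))
    find-vertex v with rep v
    ... | e , j , ne , refl , rank with turn-view e j
    ...   | inj₁ eq = contradiction eq ne
    ...   | inj₂ (p , _ , refl) = vertex e p , φ-vertex e p ,
      subst (λ c → S c ≡ true ⊎ (S c ≡ false × dist (f c (ρ c)) < dist (f e (addMod (ρ e) (suc (toℕ p)))))) (sym (owner-vertex e p)) rank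

    abstract
      σ-exists : ∀ v → ∃ λ u → φ u ≡ v × (S (owner u) ≡ true ⊎ (S (owner u) ≡ false × dist (f (owner u) (ρ (owner u))) < dist v))
      σ-exists = find-vertex

  σ : Fin m → Fin m
  σ v = proj₁ (σ-exists v)

  φ-σ : ∀ v → φ (σ v) ≡ v
  φ-σ v = proj₁ (proj₂ (σ-exists v))

  -- φ is a surjective endomap of a finite set: this is where the count of sides enters.
  σ-φ : ∀ u → σ (φ u) ≡ u
  σ-φ u with injective⇒surjective {g = σ} (λ {a} {b} eq → trans (sym (φ-σ a)) (trans (cong φ eq) (φ-σ b))) u
  ... | v , refl = cong σ (φ-σ v)

  F : Fin k → Fin m
  F c = σ (f c (ρ c))

  σ-nonbase : ∀ c p → σ (f c (addMod (ρ c) (suc (toℕ p)))) ≡ vertex c p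
  σ-nonbase c p = trans (cong σ (sym (φ-vertex c p))) (σ-φ (vertex c p))

  σ-next : ∀ c → σ (f c (sucMod (ρ c))) ≡ vertex c (next₁ c)
  σ-next c = trans (cong (λ x → σ (f c (addMod (ρ c) (suc x)))) (sym (toℕ-first (ℓ≥2 c)))) (σ-nonbase c (next₁ c))

  isomorphic : Isomorphic f (glue F)
  isomorphic = permutation σ φ σ-φ φ-σ , turn , rotated
    where
    rotated : ∀ c j → σ (f c j) ≡ glue F c (addMod j (turn c))
    rotated c j with turn-view c j
    ... | inj₁ refl = sym (trans (cong (glue F c) (turn-ρ c)) (glue-base F c))
    ... | inj₂ (p , eq , refl) = trans (σ-nonbase c p) (sym (trans (cong (glue F c) eq) (glue-nonbase F c p)))

  private
    find-preceding : ∀ d → ∃ λ p → S p ≡ true × (∀ y → S y ≡ true → δ p d ≤ δ y d)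
    find-preceding d = argmin (λ y → S y ≟ᵇ true) (λ y → δ y d) (colour 0 , colour-∈ 0)

    abstract
      preceding : ∀ d → ∃ λ p → S p ≡ true × (∀ y → S y ≡ true → δ p d ≤ δ y d)
      preceding = find-preceding

    before : Fin k → Fin k
    before d = proj₁ (preceding d)

    -- No colour of a small face lies between two consecutive ones, so the face visits `S` in cyclic
    -- order.
    before-colour : ∀ t → before (colour (suc t)) ≡ colour t
    before-colour t = δ-injectiveˡ (colour (suc t)) (≤-antisym
      (proj₂ (proj₂ (preceding (colour (suc t)))) (colour t) (colour-∈ t)) (min _ (proj₁ (proj₂ (preceding (colour (suc t)))))))
      where
      min : ∀ y → S y ≡ true → δ (colour t) (colour (suc t)) ≤ δ y (colour (suc t))
      min y y∈S with ∈-colour y y∈S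
      ... | s , refl = ≮⇒≥ λ lt → proj₂ small (it t) (it (suc t)) (it (suc s)) (it-orbit t) (next-Next (it t)) (it-orbit (suc s))
        (δ⇒CycBetween f (colour t) (colour (suc s)) (colour (suc t)) (δ-betweenˡ (colour t) (colour (suc s)) (colour (suc t)) lt))

    F-∈ : ∀ d → S d ≡ true → F d ≡ vertex (before d) (next₁ (before d))
    F-∈ d d∈S with ρ-∈ d∈S
    ... | t , eq , eq′ = begin
      σ (f d (ρ d)) ≡⟨ cong σ (trans eq′ (cong at (it-ρ t))) ⟩
      σ (f (colour t) (sucMod (ρ (colour t)))) ≡⟨ σ-next (colour t) ⟩
      vertex (colour t) (next₁ (colour t))
        ≡⟨ cong (λ y → vertex y (next₁ y)) (trans (sym (before-colour t)) (cong (before ∘ proj₁) eq)) ⟩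
      vertex (before d) (next₁ (before d)) ∎
      where open ≡-Reasoning

    -- If `d` were attached there, the small face leaving this vertex could not pass over `d`. As no
    -- member of `S` lies between `before d` and `d`, it would leave along `d` itself, putting `d`
    -- into `S`.
    F-∉ : ∀ d → S d ≡ false → ¬ (F d ≡ vertex (before d) (next₁ (before d)))
    F-∉ d d∉S eq with ρ-∈ (proj₁ (proj₂ (preceding d)))
    ... | t , itp , _ = contradiction d∉S (true≢false (subst (λ y → S y ≡ true) same (colour-∈ (suc (suc t)))))
      where
      p = before d
      d-at-p : f d (ρ d) ≡ at (it (suc t))
      d-at-p = trans (sym (φ-σ _)) (trans (cong φ (trans eq (sym (σ-next p)))) (trans (φ-σ _) (cong at (sym itp))))
      c′ = colour (suc (suc t))
      above : δ p c′ ≤ δ p d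
      above = ≮⇒≥ λ lt → proj₂ (proj₂ (proj₂ (next-Next (it (suc t))))) d (ρ d , d-at-p)
        (δ⇒CycBetween f (colour (suc t)) d c′ (subst (λ y → δ y d < δ y c′) (cong proj₁ (sym itp)) lt))
      same : c′ ≡ d
      same = δ-injectiveʳ p (≤-antisym above (≮⇒≥ λ lt →
        <⇒≱ (δ-betweenʳ p c′ d lt) (proj₂ (proj₂ (preceding d)) c′ (colour-∈ (suc (suc t))))))

    rooted : ∀ d → Rooted (block S) F d
    rooted d = <-rec Claim go (dist (f d (ρ d))) d refl
      where
      Claim : ℕ → Set
      Claim t = ∀ d → dist (f d (ρ d)) ≡ t → Rooted (block S) F d
      go : ∀ t → (∀ {s} → s < t → Claim s) → Claim t
      go t rec d refl with proj₂ (proj₂ (σ-exists (f d (ρ d))))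
      ... | inj₁ e∈S = root (cong (λ b → if b then nothing else just (owner (F d))) e∈S)
      ... | inj₂ (e∉S , lt) = step (cong (λ b → if b then nothing else just (owner (F d))) e∉S) (rec lt (owner (F d)) refl)

  good : Good S F
  good = record
    { two = colour 0 , colour 1 , colour-∈ 0 , colour-∈ 1 , distinct
    ; before = before
    ; before-∈ = λ d → proj₁ (proj₂ (preceding d))
    ; before-min = λ d → proj₂ (proj₂ (preceding d))
    ; F-∈ = F-∈
    ; F-∉ = F-∉
    ; rooted = rooted
    }
    where
    -- A face with a single corner would be a side whose two ends coincide; so the small cycle has
    -- at least two colours.
    no-loop : ∀ {z} → ¬ Next f z z
    no-loop {c , j} (j′ , eq , eq′ , _) = sucMod-≢ (ℓ≥2 c) j (trans (cong sucMod (sym (embedded c eq))) (sym eq′))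
    distinct : ¬ (colour 0 ≡ colour 1)
    distinct eq = no-loop (subst (Next f x) (sym (it-≡ 0 1 eq)) (next-Next x))

-- Counting the codes

sumFin-decodeTo : ∀ {k m} (w : Fin k → ℕ) (eq : sumFin w ≡ m) (g : Fin k → ℕ) →
  sumFin (λ v → g (proj₁ (decodeTo w eq v))) ≡ sumFin (λ c → w c * g c)
sumFin-decodeTo w refl = sumFin-decode w

sumFin-pred : ∀ {k} (ℓ : Fin k → ℕ) → (∀ c → 1 ≤ ℓ c) → sumFin ℓ ≡ sumFin (pred ∘ ℓ) + k
sumFin-pred {k} ℓ ℓ≥1 = trans (sumFin-cong λ c → positive (ℓ≥1 c)) (trans (sumFin-+ (pred ∘ ℓ) (λ _ → 1))
  (cong (sumFin (pred ∘ ℓ) +_) (trans (sumFin-const k 1) (*-identityʳ k))))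
  where
  positive : ∀ {l} → 1 ≤ l → l ≡ pred l + 1
  positive (s≤s {n = l} _) = +-comm 1 l

sumFin-mass : ∀ {k} (w : Fin k → ℕ) (S : Vec Bool k) →
  sumFin (λ c → w c * (if lookup S c then 1 else 0)) ≡ mass w S
sumFin-mass w [] = refl
sumFin-mass w (true ∷ S) = cong₂ _+_ (*-identityʳ (w zero)) (sumFin-mass (w ∘ suc) S)
sumFin-mass w (false ∷ S) = cong₂ _+_ (*-zeroʳ (w zero)) (sumFin-mass (w ∘ suc) S)

∈⇒inside : ∀ {k} (S : Vec Bool k) a → lookup S a ≡ true → 1 ≤ inside S
∈⇒inside (true ∷ S) _ _ = s≤s z≤n
∈⇒inside (false ∷ S) (suc a) a∈S = ∈⇒inside S a a∈S

two∈⇒inside : ∀ {k} (S : Vec Bool k) a b → lookup S a ≡ true → lookup S b ≡ true → ¬ (a ≡ b) → 2 ≤ inside S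
two∈⇒inside (x ∷ S) zero zero _ _ a≢b = contradiction refl a≢b
two∈⇒inside (true ∷ S) zero (suc b) _ b∈S _ = s≤s (∈⇒inside S b b∈S)
two∈⇒inside (true ∷ S) (suc a) zero a∈S _ _ = s≤s (∈⇒inside S a a∈S)
two∈⇒inside (true ∷ S) (suc a) (suc b) a∈S b∈S a≢b = m≤n⇒m≤1+n (two∈⇒inside S a b a∈S b∈S (a≢b ∘ cong suc))
two∈⇒inside (false ∷ S) (suc a) (suc b) a∈S b∈S a≢b = two∈⇒inside S a b a∈S b∈S (a≢b ∘ cong suc)

inside⇒∈ : ∀ {k} (S : Vec Bool k) → 1 ≤ inside S → ∃ λ a → lookup S a ≡ true
inside⇒∈ (true ∷ S) _ = zero , refl
inside⇒∈ (false ∷ S) le = let a , a∈S = inside⇒∈ S le in suc a , a∈S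

inside⇒two∈ : ∀ {k} (S : Vec Bool k) → 2 ≤ inside S →
  ∃₂ λ a b → lookup S a ≡ true × lookup S b ≡ true × ¬ (a ≡ b)
inside⇒two∈ (true ∷ S) (s≤s le) = let b , b∈S = inside⇒∈ S le in zero , suc b , refl , b∈S , λ ()
inside⇒two∈ (false ∷ S) le =
  let a , b , a∈S , b∈S , a≢b = inside⇒two∈ S le in suc a , suc b , a∈S , b∈S , a≢b ∘ Fin.suc-injective

lookup-injective : ∀ {k} (S T : Vec Bool k) → (∀ c → lookup S c ≡ lookup T c) → S ≡ T
lookup-injective [] [] eq = refl
lookup-injective (x ∷ S) (y ∷ T) eq = cong₂ _∷_ (eq zero) (lookup-injective S T (eq ∘ suc))

≡-by-true : ∀ {a b} → (a ≡ true → b ≡ true) → (b ≡ true → a ≡ true) → a ≡ b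
≡-by-true {true} to _ = sym (to refl)
≡-by-true {false} {true} _ from with () ← from refl
≡-by-true {false} {false} _ _ = refl

module Count {k : ℕ} (ℓ : Fin k → ℕ) (ℓ≥2 : ∀ c → 2 ≤ ℓ c) (n : ℕ) (total : sumFin (pred ∘ ℓ) ≡ suc n) where
  open Normal ℓ ℓ≥2 total

  Good-resp : ∀ {S S′ F} → (∀ c → S c ≡ S′ c) → Good S F → Good S′ F
  Good-resp {S} {S′} {F} eq good = record
    { two = let a , b , a∈S , b∈S , a≢b = two in a , b , trans (sym (eq a)) a∈S , trans (sym (eq b)) b∈S , a≢b
    ; before = before
    ; before-∈ = λ d → trans (sym (eq _)) (before-∈ d)
    ; before-min = λ d x x∈S′ → before-min d x (trans (eq x) x∈S′)
    ; F-∈ = λ d d∈S′ → F-∈ d (trans (eq d) d∈S′)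
    ; F-∉ = λ d d∉S′ → F-∉ d (trans (eq d) d∉S′)
    ; rooted = λ d → transport (rooted d)
    }
    where
    open Good good
    block-≡ : ∀ v → block S′ v ≡ block S v
    block-≡ v = cong (λ b → if b then nothing else just (owner v)) (sym (eq (owner v)))
    transport : ∀ {d} → Rooted (block S) F d → Rooted (block S′) F d
    transport (root e) = root (trans (block-≡ _) e)
    transport (step e re) = step (trans (block-≡ _) e) (transport re)

  module _ (S : Vec Bool k) (le : 2 ≤ inside S) where
    private
      preceding : ∀ d → ∃ λ p → lookup S p ≡ true × (∀ x → lookup S x ≡ true → δ p d ≤ δ x d)
      preceding d = argmin (λ x → lookup S x ≟ᵇ true) (λ x → δ x d) (inside⇒∈ S (<⇒≤ le))

      q : Fin k → Fin (suc n)
      q d = vertex (proj₁ (preceding d)) (next₁ (proj₁ (preceding d)))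

      core : ∀ d → block (lookup S) (q d) ≡ nothing
      core d = cong (λ b → if b then nothing else just (owner (q d)))
        (trans (cong (lookup S) (owner-vertex _ _)) (proj₁ (proj₂ (preceding d))))

      size : sumFin (inCore ∘ block (lookup S)) ≡ mass (pred ∘ ℓ) S
      size = trans (sumFin-cong λ v → indicator (lookup S (owner v)) (owner v))
        (trans (sumFin-decodeTo (pred ∘ ℓ) total (λ c → if lookup S c then 1 else 0)) (sumFin-mass (pred ∘ ℓ) S))
        where
        indicator : ∀ b c → inCore (if b then nothing else just c) ≡ (if b then 1 else 0)
        indicator true c = refl
        indicator false c = refl

      Forest⇒Good : ∀ F → Forest S q (block (lookup S)) F → Good (lookup S) F
      Forest⇒Good F (F-∈ , F-∉ , rooted) = record
        { two = inside⇒two∈ S le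
        ; before = λ d → proj₁ (preceding d)
        ; before-∈ = λ d → proj₁ (proj₂ (preceding d))
        ; before-min = λ d → proj₂ (proj₂ (preceding d))
        ; F-∈ = F-∈ ; F-∉ = F-∉ ; rooted = rooted
        }

      Good⇒Forest : ∀ F → Good (lookup S) F → Forest S q (block (lookup S)) F
      Good⇒Forest F good = (λ d d∈S → trans (F-∈ d d∈S) (q-≡ d)) , (λ d d∉S eq → F-∉ d d∉S (trans eq (sym (q-≡ d)))) , rooted
        where
        open Good good
        q-≡ : ∀ d → vertex (before d) (next₁ (before d)) ≡ q d
        q-≡ d = cong (λ x → vertex x (next₁ x)) (δ-injectiveˡ d (≤-antisym
          (before-min d _ (proj₁ (proj₂ (preceding d)))) (proj₂ (proj₂ (preceding d)) _ (before-∈ d))))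

    count-large : ∃ λ X → NumberUpTo _≗_ (Good (lookup S)) X × X * n ≡ pred (mass (pred ∘ ℓ) S) * n ^ outside S
    count-large =
      let X , count , eq = forest-count S q (block (lookup S)) (pred (mass (pred ∘ ℓ) S)) core
            (λ d v d∈S eq → true≢false d∈S (proj₂ (block-just (lookup S) v eq)))
            (trans size (positive (≤-trans (<⇒≤ le) (inside≤mass (pred ∘ ℓ) (λ c → ℓ≥2⇒ (ℓ≥2 c)) S))))
      in X , number-⇔ Forest⇒Good Good⇒Forest count , eq
      where
      positive : ∀ {l} → 1 ≤ l → l ≡ suc (pred l)
      positive (s≤s _) = refl
      ℓ≥2⇒ : ∀ {l} → 2 ≤ l → 1 ≤ pred l
      ℓ≥2⇒ (s≤s le) = le

  count-each : ∀ S → ∃ λ X → NumberUpTo _≗_ (Good (lookup S)) X ×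
    X * n ≡ is≥2 (inside S) * (pred (mass (pred ∘ ℓ) S) * n ^ outside S)
  count-each S with inside S in eq
  ... | suc (suc i) = let X , count , eq′ = count-large S (subst (2 ≤_) (sym eq) (s≤s (s≤s z≤n))) in
    X , count , trans eq′ (sym (*-identityˡ _))
  ... | 0 = 0 , number-empty (λ F good → let a , b , a∈S , b∈S , a≢b = Good.two good in
    contradiction (subst (2 ≤_) eq (two∈⇒inside S a b a∈S b∈S a≢b)) λ ()) , refl
  ... | 1 = 0 , number-empty (λ F good → let a , b , a∈S , b∈S , a≢b = Good.two good in
    contradiction (subst (2 ≤_) eq (two∈⇒inside S a b a∈S b∈S a≢b)) λ { (s≤s ()) }) , refl

  -- By `core-⊆` a code determines its set of colours, so the counts for different sets add up.
  count-all : NumberUpTo _≗_ (λ F → ∃ λ S → Good (lookup S) F) (sumVec λ S → proj₁ (count-each S))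
  count-all = number-Vec
    (λ S T F G good good′ eq → lookup-injective S T λ c → ≡-by-true
      (core-⊆ good good′ eq c) (core-⊆ good′ good (λ d → sym (eq d)) c))
    (λ S → proj₁ (proj₂ (count-each S)))
    where open Uniqueness ℓ ℓ≥2 total

theorem6 : (k : ℕ) → 2 ≤ k → (ℓ : Fin k → ℕ) → (∀ c → 2 ≤ ℓ c) →
    (n : ℕ) → 1 ≤ n → sumFin ℓ ≡ n + k + 1 →
    NumberUpTo (Isomorphic {k} {ℓ} {suc n}) (IsOneNConstellation k ℓ n)
    ((k ∸ 1) * n ^ (k ∸ 2))
theorem6 (suc zero) (s≤s ())
theorem6 (suc (suc k)) _ ℓ ℓ≥2 n n≥1 sides =
  subst (NumberUpTo Isomorphic (IsOneNConstellation (suc (suc k)) ℓ n))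
    (sum-forests n k (pred ∘ ℓ) {{>-nonZero n≥1}} w≥1 total (λ S → proj₁ (count-each S)) (λ S → proj₂ (proj₂ (count-each S))))
    (number-map glue sound reflects complete respects count-all)
  where
  total : sumFin (pred ∘ ℓ) ≡ suc n
  total = +-cancelʳ-≡ (suc (suc k)) _ _
    (trans (sym (sumFin-pred ℓ (λ c → <⇒≤ (ℓ≥2 c)))) (trans sides (+-comm (n + suc (suc k)) 1)))

  w≥1 : ∀ c → 1 ≤ pred (ℓ c)
  w≥1 c = ∸-monoˡ-≤ 1 (ℓ≥2 c)

  open Normal ℓ ℓ≥2 total
  open Count ℓ ℓ≥2 n total

  Code : (Fin (suc (suc k)) → Fin (suc n)) → Set
  Code F = ∃ λ S → Good (lookup S) F

  sound : ∀ F → Code F → IsOneNConstellation (suc (suc k)) ℓ n (glue F)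
  sound F (S , good) = embedded , connected , euler , small , big , proj₁ two-faces , proj₂ two-faces , small-face
    where
    open Soundness ℓ ℓ≥2 total (lookup S) F good
    regroup : ∀ n k → suc n + (k + 2) ≡ n + k + 1 + 2
    regroup = solve-∀
    euler : suc n + (suc (suc k) + 2) ≡ sumFin ℓ + 2
    euler = trans (regroup n (suc (suc k))) (cong (_+ 2) (sym sides))

  reflects : ∀ F G → Code F → Code G → Isomorphic (glue F) (glue G) → F ≗ G
  reflects F G (_ , good) (_ , good′) (π , r , iso) = Uniqueness.iso-≡ ℓ ℓ≥2 total good good′ π r iso

  complete : ∀ f → IsOneNConstellation (suc (suc k)) ℓ n f → ∃ λ F → Code F × Isomorphic f (glue F)
  complete f (embedded , connected , _ , x , _ , _ , _ , small) =
    C.F , (tabulate C.S , Good-resp (λ c → sym (lookup∘tabulate C.S c)) C.good) , C.isomorphic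
    where module C = Completeness ℓ ℓ≥2 total f embedded connected x small

  respects : ∀ f F G → Isomorphic f (glue F) → F ≗ G → Isomorphic f (glue G)
  respects f F G (π , r , iso) eq = π , r , λ c j → trans (iso c j) (glue-cong c (addMod j (r c)))
    where
    glue-cong : ∀ c j → glue F c j ≡ glue G c j
    glue-cong c j with corner-view (ℓ≥2 c) j
    ... | inj₁ _ = eq c
    ... | inj₂ _ = refl
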